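{- (1) For any $r\ge0$ and odd primes $p_1,\ldots,p_r$ (not necessarily distinct), \[ \sum_{n=0}^{\infty}b_4\!\left(\prod_{s=1}^{r}p_s^2\,n+\frac{\prod_{s=1}^{r}p_s^2-1}{8}\right)q^n \equiv \psi(q) \pmod 2, \] where $\prod_{s=1}^{0}p_s^2=1$. (2) For any $r\ge1$, odd primes $p_1,\ldots,p_r$ and $n\ge0$, \[ b_4\!\left(\prod_{s=1}^{r}p_s^2\, n+\frac{(8i+p_{r})\prod_{s=1}^{r-1}p_s^2\,p_{r}-1}{8}\right)\equiv 0 \pmod 2 \] for each $i=1,2,\ldots,p_r-1$. (3) For any $r\ge1$, odd primes $p_1,\ldots,p_r$ and $n\ge0$, \[ b_4\!\left(\prod_{s=1}^{r-1}p_s^2\,p_{r}\, n+\frac{(8j+1)\prod_{s=1}^{r-1}p_s^2-1}{8}\right)\equiv 0 \pmod 2 \] for every integer $j$ with $0\le j\le p_r-1$ and $\left(\frac{8j+1}{p_r}\right)=-1$.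
   Context: For a positive integer $\ell$, $b_\ell(n)$ denotes the number of partitions of $n$ having no part divisible by $\ell$. $\psi(q)=\sum_{n\ge0}q^{n(n+1)/2}$. A congruence between power series modulo $2$ means coefficientwise congruence. $\left(\frac{a}{p}\right)$ is the Legendre symbol. -}

module Defs where

open import Algebra.Definitions.RawMonoid using () renaming (sum to fold)
open import Data.Empty using (⊥-elim)
open import Data.Fin using (Fin; toℕ; zero; suc; inject₁; fromℕ)
open import Data.Fin.Properties using () renaming (any? to anyFin?)
open import Data.Integer using (ℤ; 0ℤ; 1ℤ; -1ℤ)
import Data.Integer as ℤ
import Data.Integer.Divisibility as ℤ
open import Data.List using (List; []; _∷_; [_]; _++_; map; concatMap; filter; length; replicate; upTo)
open import Data.List.Membership.Propositional using (_∈_; lose; find)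
open import Data.List.Membership.Propositional.Properties using (∈-concatMap⁺; ∈-concatMap⁻; ∈-map⁺; ∈-map⁻; ∈-upTo⁺; ∈-upTo⁻)
open import Data.List.Properties using (∷-injectiveʳ; ++-cancelˡ)
open import Data.List.Relation.Binary.Disjoint.Propositional using (Disjoint)
open import Data.List.Relation.Unary.All using (All; []; _∷_; all?)
import Data.List.Relation.Unary.All as All
import Data.List.Relation.Unary.All.Properties as All
open import Data.List.Relation.Unary.AllPairs using (AllPairs; []; _∷_)
import Data.List.Relation.Unary.AllPairs as AllPairs
import Data.List.Relation.Unary.AllPairs.Properties as AllPairs
open import Data.List.Relation.Unary.Any using (here)
open import Data.List.Relation.Unary.Linked using (Linked)
open import Data.List.Relation.Unary.Linked.Properties using (Linked⇒AllPairs; AllPairs⇒Linked)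
open import Data.List.Relation.Unary.Unique.Propositional using (Unique)
import Data.List.Relation.Unary.Unique.Propositional.Properties as Unique
open import Data.Nat using (ℕ; zero; suc; _+_; _*_; _∸_; _^_; _≤_; _<_; _≥_; z≤n; s≤s; _≟_; ∣_-_∣; *-1-rawMonoid)
open import Data.Nat.DivMod using (_/_; _%_; m*n/n≡m; m/n*n≤m; /-monoˡ-≤; m≡m%n+[m/n]*n; %-distribˡ-*; [m+kn]%n≡m%n; m%n<n)
open import Data.Nat.Divisibility using (_∣_; _∤_; _∣?_; divides; ∣m∣n⇒∣m+n; ∣n⇒∣m*n)
open import Data.Nat.ListAction using (sum)
open import Data.Nat.ListAction.Properties using (sum-++)
open import Data.Nat.Primality using (Prime)
open import Data.Nat.Properties
open import Data.Product using (∃; _×_; _,_; proj₁; proj₂)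
open import Data.Vec.Functional using (Vector; init; last)
open import Function using (_∘_; _⇔_; mk⇔)
open import Relation.Binary.PropositionalEquality hiding ([_])
open import Relation.Nullary using (¬_; Dec; yes; no; ¬?)

record IsPartition (n : ℕ) (xs : List ℕ) : Set where
  constructor isPartition
  field
    decreasing : Linked _≥_ xs
    positive   : All (0 <_) xs
    total      : sum xs ≡ n

-- The partitions of n into parts at most k, sorted by the multiplicity m of
-- the part k.
partitions≤ : (k n : ℕ) → List (List ℕ)
partitions≤ zero    zero    = [ [] ]
partitions≤ zero    (suc n) = []
partitions≤ (suc k) n       = concatMap
  (λ m → map (replicate m (suc k) ++_) (partitions≤ k (n ∸ m * suc k)))
  (upTo (suc (n / suc k)))

-- ∈-partitions and partitions-unique below show that this list contains
-- every partition of n exactly once and nothing else.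
partitions : ℕ → List (List ℕ)
partitions n = partitions≤ n n

Regular : ℕ → List ℕ → Set
Regular ℓ = All (ℓ ∤_)

regular? : ∀ ℓ xs → Dec (Regular ℓ xs)
regular? ℓ = all? (λ x → ¬? (ℓ ∣? x))

b : ℕ → ℕ → ℕ
b ℓ n = length (filter (regular? ℓ) (partitions n))

-- A power series in q, given by its coefficients.
PowerSeries : Set
PowerSeries = ℕ → ℕ

infix 4 _≡_[mod_] _≋_[mod_]

_≡_[mod_] : ℕ → ℕ → ℕ → Set
x ≡ y [mod m ] = m ∣ ∣ x - y ∣

_≋_[mod_] : PowerSeries → PowerSeries → ℕ → Set
f ≋ g [mod m ] = ∀ n → f n ≡ g n [mod m ]

triangular : ℕ → ℕ
triangular k = k * (k + 1) / 2

-- The coefficient of q^n is the number of k ≥ 0 with k(k+1)/2 = n; the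
-- search may stop at k = n by triangular-≥.
ψ : PowerSeries
ψ n = length (filter (λ k → triangular k ≟ n) (upTo (suc n)))

-- x runs through a complete system of residues modulo p.
SquareMod : ℕ → ℤ → Set
SquareMod p a = ∃ λ (x : Fin p) → ℤ.+ p ℤ.∣ (ℤ.+ toℕ x) ℤ.^ 2 ℤ.- a

squareMod? : ∀ p a → Dec (SquareMod p a)
squareMod? p a = anyFin? λ x → p ∣? ℤ.∣ (ℤ.+ toℕ x) ℤ.^ 2 ℤ.- a ∣

legendre : ℤ → ℕ → ℤ
legendre a p with p ∣? ℤ.∣ a ∣ | squareMod? p a
... | yes _ | _     = 0ℤ
... | no  _ | yes _ = 1ℤ
... | no  _ | no  _ = -1ℤ

OddPrime : ℕ → Set
OddPrime p = Prime p × 2 ∤ p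

∏² : ∀ {r} → Vector ℕ r → ℕ
∏² p = fold *-1-rawMonoid (λ s → p s ^ 2)

private
  odd-square : ∀ x → 2 ∤ x → x * x % 8 ≡ 1
  odd-square x odd = trans (%-distribˡ-* x x 8) (cases (x % 8) (m%n<n x 8) odd%)
    where
    odd% : 2 ∤ x % 8
    odd% 2∣ = odd (subst (2 ∣_) (sym (m≡m%n+[m/n]*n x 8))
                  (∣m∣n⇒∣m+n 2∣ (∣n⇒∣m*n (x / 8) (divides 4 refl))))
    cases : ∀ y → y < 8 → 2 ∤ y → y * y % 8 ≡ 1
    cases 0 _ o = ⊥-elim (o (divides 0 refl))
    cases 1 _ _ = refl
    cases 2 _ o = ⊥-elim (o (divides 1 refl))
    cases 3 _ _ = refl
    cases 4 _ o = ⊥-elim (o (divides 2 refl))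
    cases 5 _ _ = refl
    cases 6 _ o = ⊥-elim (o (divides 3 refl))
    cases 7 _ _ = refl
    cases (suc (suc (suc (suc (suc (suc (suc (suc y)))))))) lt _ =
      ⊥-elim (m+n≮m 8 y lt)

  %-* : ∀ x y → x % 8 ≡ 1 → y % 8 ≡ 1 → x * y % 8 ≡ 1
  %-* x y p q = trans (%-distribˡ-* x y 8) (cong₂ (λ u v → u * v % 8) p q)

  ∏²%8 : ∀ {r} (p : Vector ℕ r) → (∀ s → OddPrime (p s)) → ∏² p % 8 ≡ 1
  ∏²%8 {zero}  p op = refl
  ∏²%8 {suc r} p op = %-* (p zero ^ 2) (∏² (p ∘ suc))
    (subst (λ z → p zero * z % 8 ≡ 1) (sym (*-identityʳ (p zero)))
      (odd-square (p zero) (proj₂ (op zero))))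
    (∏²%8 (p ∘ suc) (op ∘ suc))

  exact : ∀ m → m % 8 ≡ 1 → (m ∸ 1) / 8 * 8 + 1 ≡ m
  exact m eq = begin
    (m ∸ 1) / 8 * 8 + 1       ≡⟨ cong (λ z → z / 8 * 8 + 1) (cong (_∸ 1) m≡) ⟩
    (m / 8 * 8) / 8 * 8 + 1   ≡⟨ cong (λ z → z * 8 + 1) (m*n/n≡m (m / 8) 8) ⟩
    m / 8 * 8 + 1             ≡⟨ +-comm _ 1 ⟩
    1 + m / 8 * 8             ≡⟨ m≡ ⟨
    m                         ∎
    where
    open ≡-Reasoning
    m≡ : m ≡ 1 + m / 8 * 8
    m≡ = trans (m≡m%n+[m/n]*n m 8) (cong (_+ m / 8 * 8) eq)

-- For odd primes the numerators (m ∸ 1) below are divisible by 8 and m ≥ 1,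
-- so truncated subtraction and floor division give the true quotients
-- (m - 1)/8 (exact₁, exact₂, exact₃).
exact₁ : ∀ {r} (p : Vector ℕ r) → (∀ s → OddPrime (p s)) →
         (∏² p ∸ 1) / 8 * 8 + 1 ≡ ∏² p
exact₁ p op = exact _ (∏²%8 p op)

exact₂ : ∀ {r} (p : Vector ℕ (suc r)) → (∀ s → OddPrime (p s)) → ∀ i →
         let m = (8 * i + last p) * (∏² (init p) * last p) in
         (m ∸ 1) / 8 * 8 + 1 ≡ m
exact₂ {r} p op i = exact _ (subst (λ z → z % 8 ≡ 1) eq
  (%-* Q ((8 * i + l) * l) (∏²%8 (init p) (op ∘ inject₁)) lemma))
  where
  Q = ∏² (init p)
  l = last p
  lemma : (8 * i + l) * l % 8 ≡ 1
  lemma = trans (cong (_% 8) (trans (*-distribʳ-+ l (8 * i) l)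
            (trans (+-comm (8 * i * l) (l * l))
            (cong (l * l +_) (trans (*-assoc 8 i l) (*-comm 8 (i * l)))))))
            (trans ([m+kn]%n≡m%n (l * l) (i * l) 8) (odd-square l (proj₂ (op (fromℕ r)))))
  eq : Q * ((8 * i + l) * l) ≡ (8 * i + l) * (Q * l)
  eq = trans (sym (*-assoc Q (8 * i + l) l))
       (trans (cong (_* l) (*-comm Q (8 * i + l))) (*-assoc (8 * i + l) Q l))

exact₃ : ∀ {r} (p : Vector ℕ r) → (∀ s → OddPrime (p s)) → ∀ j →
         let m = (8 * j + 1) * ∏² p in
         (m ∸ 1) / 8 * 8 + 1 ≡ m
exact₃ p op j = exact _ (%-* (8 * j + 1) (∏² p)
  (trans (cong (_% 8) (trans (+-comm (8 * j) 1) (cong (1 +_) (*-comm 8 j))))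
         ([m+kn]%n≡m%n 1 j 8))
  (∏²%8 p op))

triangular-≥ : ∀ k → k ≤ triangular k
triangular-≥ zero    = z≤n
triangular-≥ (suc k) = subst (_≤ triangular (suc k)) (m*n/n≡m (suc k) 2)
  (/-monoˡ-≤ 2 (*-monoʳ-≤ (suc k) (s≤s (m≤n+m 1 k))))

private
  Bounded : ℕ → List ℕ → Set
  Bounded k = All (λ x → 0 < x × x ≤ k)

  sum-replicate : ∀ m x → sum (replicate m x) ≡ m * x
  sum-replicate zero    x = refl
  sum-replicate (suc m) x = cong (x +_) (sum-replicate m x)

  step : ℕ → ℕ → ℕ → List (List ℕ)
  step k n m = map (replicate m (suc k) ++_) (partitions≤ k (n ∸ m * suc k))

  sound : ∀ k n {xs} → xs ∈ partitions≤ k n →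
          AllPairs _≥_ xs × Bounded k xs × sum xs ≡ n
  sound zero    zero (here refl) = [] , [] , refl
  sound (suc k) n {xs} xs∈ with find (∈-concatMap⁻ (step k n) {xs = upTo (suc (n / suc k))} xs∈)
  ... | m , m∈ , xs∈′ with ∈-map⁻ (replicate m (suc k) ++_) xs∈′
  ... | ys , ys∈ , refl with sound k _ ys∈
  ... | ≥ys , bd , eq =
      AllPairs.++⁺ (≥rep m) ≥ys (All.replicate⁺ m (All.map (m≤n⇒m≤1+n ∘ proj₂) bd))
    , All.++⁺ (All.replicate⁺ m (s≤s z≤n , ≤-refl)) (All.map (λ (p , q) → p , m≤n⇒m≤1+n q) bd)
    , trans (sum-++ (replicate m (suc k)) ys)
        (trans (cong₂ _+_ (sum-replicate m (suc k)) eq) (m+[n∸m]≡n m*k≤n))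
    where
    ≥rep : ∀ m → AllPairs _≥_ (replicate m (suc k))
    ≥rep zero    = []
    ≥rep (suc m) = All.replicate⁺ m ≤-refl ∷ ≥rep m
    m*k≤n : m * suc k ≤ n
    m*k≤n = ≤-trans (*-monoˡ-≤ (suc k) (≤-pred (∈-upTo⁻ m∈))) (m/n*n≤m n (suc k))

  split : ∀ k {xs} → AllPairs _≥_ xs → Bounded (suc k) xs →
          ∃ λ m → ∃ λ ys → xs ≡ replicate m (suc k) ++ ys × AllPairs _≥_ ys × Bounded k ys
  split k [] [] = 0 , [] , refl , [] , []
  split k {x ∷ xs} (x≥ ∷ ≥xs) ((0<x , x≤) ∷ bd) with x ≟ suc k
  ... | yes refl with split k ≥xs bd
  ...   | m , ys , refl , ≥ys , bd′ = suc m , ys , refl , ≥ys , bd′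
  split k {x ∷ xs} (x≥ ∷ ≥xs) ((0<x , x≤) ∷ bd) | no x≢ =
    0 , x ∷ xs , refl , x≥ ∷ ≥xs , (0<x , x≤k)
      ∷ All.zipWith (λ (y≤x , 0<y , _) → 0<y , ≤-trans y≤x x≤k) (x≥ , bd)
    where
    x≤k : x ≤ k
    x≤k = ≤-pred (≤∧≢⇒< x≤ x≢)

  complete : ∀ k {xs} → AllPairs _≥_ xs → Bounded k xs → xs ∈ partitions≤ k (sum xs)
  complete zero    [] [] = here refl
  complete zero    (_ ∷ _) ((s≤s _ , ()) ∷ _)
  complete (suc k) ≥xs bd with split k ≥xs bd
  ... | m , ys , refl , ≥ys , bd′ =
    ∈-concatMap⁺ (step k (sum xs))
      (lose (∈-upTo⁺ (s≤s m≤)) (∈-map⁺ (replicate m (suc k) ++_)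
        (subst (λ z → ys ∈ partitions≤ k z) (sym rest) (complete k ≥ys bd′))))
    where
    xs = replicate m (suc k) ++ ys
    sum≡ : sum xs ≡ m * suc k + sum ys
    sum≡ = trans (sum-++ (replicate m (suc k)) ys) (cong (_+ sum ys) (sum-replicate m (suc k)))
    rest : sum xs ∸ m * suc k ≡ sum ys
    rest = trans (cong (_∸ m * suc k) sum≡) (m+n∸m≡n (m * suc k) (sum ys))
    m≤ : m ≤ sum xs / suc k
    m≤ = subst (_≤ sum xs / suc k) (m*n/n≡m m (suc k))
           (/-monoˡ-≤ (suc k) (subst (m * suc k ≤_) (sym sum≡) (m≤m+n _ _)))

  multiplicity : ∀ k m m′ {ys ys′} → Bounded k ys → Bounded k ys′ →
                 replicate m (suc k) ++ ys ≡ replicate m′ (suc k) ++ ys′ → m ≡ m′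
  multiplicity k zero    zero     _ _ _ = refl
  multiplicity k zero    (suc m′) ((_ , x≤k) ∷ _) _ refl = ⊥-elim (1+n≰n x≤k)
  multiplicity k (suc m) zero     _ ((_ , x≤k) ∷ _) refl = ⊥-elim (1+n≰n x≤k)
  multiplicity k (suc m) (suc m′) bd bd′ eq =
    cong suc (multiplicity k m m′ bd bd′ (∷-injectiveʳ eq))

  unique : ∀ k n → Unique (partitions≤ k n)
  unique zero    zero    = [] ∷ []
  unique zero    (suc n) = []
  unique (suc k) n = Unique.concat⁺
    (All.map⁺ (All.universal (λ m → Unique.map⁺ (++-cancelˡ (replicate m (suc k)) _ _) (unique k _)) _))
    (AllPairs.map⁺ (AllPairs.map disjoint (Unique.upTo⁺ (suc (n / suc k)))))
    where
    disjoint : ∀ {m m′} → m ≢ m′ → Disjoint (step k n m) (step k n m′)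
    disjoint {m} {m′} m≢m′ (v∈ , v∈′)
      with ∈-map⁻ (replicate m (suc k) ++_) v∈ | ∈-map⁻ (replicate m′ (suc k) ++_) v∈′
    ... | ys , ys∈ , eq | ys′ , ys′∈ , eq′ =
      m≢m′ (multiplicity k m m′ (proj₁ (proj₂ (sound k _ ys∈)))
             (proj₁ (proj₂ (sound k _ ys′∈))) (trans (sym eq) eq′))

  parts-≤ : ∀ xs → All (_≤ sum xs) xs
  parts-≤ []       = []
  parts-≤ (x ∷ xs) = m≤m+n x (sum xs) ∷ All.map (λ p → ≤-trans p (m≤n+m (sum xs) x)) (parts-≤ xs)

∈-partitions : ∀ n xs → xs ∈ partitions n ⇔ IsPartition n xs
∈-partitions n xs = mk⇔ to from
  where
  to : xs ∈ partitions n → IsPartition n xs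
  to xs∈ with sound n n xs∈
  ... | ≥xs , bd , eq = isPartition (AllPairs⇒Linked ≥xs) (All.map proj₁ bd) eq
  from : IsPartition n xs → xs ∈ partitions n
  from (isPartition dec pos refl) =
    complete n (Linked⇒AllPairs (λ p q → ≤-trans q p) dec) (All.zip (pos , parts-≤ xs))

partitions-unique : ∀ n → Unique (partitions n)
partitions-unique n = unique n n

{-# OPTIONS --safe #-}

-- Parts at most 4m that are not multiples of 4 are 4i+1, 4i+2, 4i+3, so modulo 2
-- the generating function of b₄ is the inverse of (-q; q²)₂ₘ (-q²; q⁴)ₘ up to
-- q⁴ᵐ. Shanks's telescoping identity evaluates (-q; q²)₂ₘ ∑ q^{k(k+1)/2} as
-- (-q²; q²)₂ₘ up to q⁴ᵐ, and Euler's factorisation together with the Frobenius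
-- (1 + x)² = 1 + x² identifies the two; hence b₄(n) ≡ ψ(n), the indicator of
-- 8n + 1 being a square. If N is the
-- argument of b₄ in the theorem, then 8N + 1 is, up to a square factor ∏ pₛ²,
-- 8n + 1, p (p (8n + 1) + 8i), and 8 (pn + j) + 1 in the three cases.
module Submission where

open import Defs
open import Algebra.Bundles using (CommutativeRing)
import Algebra.Properties.CommutativeSemigroup
import Algebra.Properties.Semiring.Exp
import Algebra.Solver.Ring
open import Algebra.Solver.Ring.AlmostCommutativeRing
  using (AlmostCommutativeRing; fromCommutativeSemiring; _-Raw-AlmostCommutative⟶_)
open import Data.Fin using (Fin; fromℕ<; inject₁; fromℕ)
open import Data.Fin.Properties using (toℕ-fromℕ<)
import Data.Integer as ℤ
import Data.Integer.Divisibility.Signed as ℤ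
import Data.Integer.Properties as ℤ
import Data.Integer.Tactic.RingSolver as ℤSolver
open import Data.List as List using (List; []; _∷_; _++_; map; concatMap; filter; length; replicate; upTo; applyUpTo)
import Data.List.Properties as List
open import Data.List.Relation.Unary.All using (_∷_)
open import Data.Maybe using (Maybe; just; nothing)
open import Data.Nat as ℕ using (ℕ; zero; suc; s≤s; z≤n; parity; NonZero; >-nonZero; >-nonZero⁻¹)
open import Data.Nat.DivMod
open import Data.Nat.Divisibility hiding (quotient)
open import Data.Nat.Primality using (Prime; euclidsLemma; prime⇒nonZero; prime⇒nonTrivial; prime⇒irreducible; prime?)
import Data.Nat.Properties as ℕ
open import Data.Nat.Tactic.RingSolver using (solve-∀)
open import Data.Parity using (Parity; 0ℙ; 1ℙ; _⁻¹)
import Data.Parity.Properties as ℙ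
open import Data.Product using (∃; _×_; _,_; proj₁)
open import Data.Sum using (_⊎_; inj₁; inj₂; [_,_]′)
open import Data.Vec.Functional using (Vector; init; last)
open import Function using (_∘_; id)
open import Level using (Level; 0ℓ)
open import Relation.Binary.PropositionalEquality
  using (_≡_; _≢_; _≗_; refl; sym; trans; cong; cong₂; subst; module ≡-Reasoning)
import Relation.Binary.Reasoning.Setoid
open import Relation.Nullary using (¬_; Dec; yes; no; contradiction)
open import Relation.Nullary.Decidable using (from-no; toWitness; map′)

-- Classically the congruence between b₄ and ψ comes from Gauss's product for ψ. Here no limit is
-- taken and no quotient of series is formed: every product is finite, and every comparison carries
-- an explicit remainder, a power of q times a witness. Shanks's sum suits this because all its
-- summands but the first are divisible by a high power of q. In characteristic 2 its signs
-- disappear, and the lower boundary of the telescope is a multiple of 1 + 1.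
--
-- Write g for (-q²; q²)₂ₘ. Shanks gives g as (-q; q²)₂ₘ times a partial sum of ψ, Euler gives it as
-- (-q²; q⁴)ₘ (-q⁴; q⁴)ₘ, and Frobenius turns g² into (-q⁴; q⁴)ₘ up to a remainder. This is why the
-- two series are compared after multiplication by (-q⁴; q⁴)ₘ. Its constant coefficient is 1, so it
-- can be cancelled even when equality is known only modulo a power of q.

-- Finite products in a commutative ring of characteristic 2.

module Characteristic2 {κ ℓ : Level} (R : CommutativeRing κ ℓ)
  (1+1≈0 : CommutativeRing._≈_ R (CommutativeRing._+_ R (CommutativeRing.1# R) (CommutativeRing.1# R)) (CommutativeRing.0# R))
  where

  open CommutativeRing R hiding (zero) renaming (refl to ≈-refl; sym to ≈-sym; trans to ≈-trans)
  open Algebra.Properties.Semiring.Exp semiring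
  open Relation.Binary.Reasoning.Setoid setoid

  private
    ACR : AlmostCommutativeRing κ ℓ
    ACR = fromCommutativeSemiring commutativeSemiring

    constant : Parity → Carrier
    constant 0ℙ = 0#
    constant 1ℙ = 1#

    -- Coefficients in the two-element field let the ring solver prove identities that depend on 1 +
    -- 1 = 0.
    morphism : CommutativeRing.rawRing ℙ.+-*-commutativeRing -Raw-AlmostCommutative⟶ ACR
    morphism = record
      { ⟦_⟧    = constant
      ; +-homo = λ { 0ℙ q → ≈-sym (+-identityˡ _) ; 1ℙ 0ℙ → ≈-sym (+-identityʳ _) ; 1ℙ 1ℙ → ≈-sym 1+1≈0 }
      ; *-homo = λ { 0ℙ q → ≈-sym (zeroˡ _) ; 1ℙ q → ≈-sym (*-identityˡ _) }
      ; -‿homo = λ _ → ≈-refl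
      ; 0-homo = ≈-refl
      ; 1-homo = ≈-refl
      }

    constant≟ : ∀ p q → Maybe (constant p ≈ constant q)
    constant≟ p q with p ℙ.≟ q
    ... | yes refl = just ≈-refl
    ... | no _     = nothing

  module Solver = Algebra.Solver.Ring _ ACR morphism constant≟
  open Solver using (solve; _:+_; _:*_; _:=_; con)

  -- (-x; x)ₙ
  euler : Carrier → ℕ → Carrier
  euler x zero    = 1#
  euler x (suc n) = euler x n * (1# + x ^ suc n)

  -- (-x; x²)ₙ
  eulerOdd : Carrier → ℕ → Carrier
  eulerOdd x zero    = 1#
  eulerOdd x (suc n) = eulerOdd x n * (1# + x ^ suc (2 ℕ.* n))

  ^-square : ∀ x n → (x * x) ^ n ≈ x ^ (2 ℕ.* n)
  ^-square x n = ≈-trans (^-congˡ n (≈-sym (*-congˡ (*-identityʳ x)))) (^-assocʳ x 2 n)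

  ^-double : ∀ x n → x ^ (2 ℕ.* n) ≈ x ^ n * x ^ n
  ^-double x n = ≈-trans (^-congʳ x (cong (n ℕ.+_) (ℕ.+-identityʳ n))) (^-homo-* x n n)

  -- Frobenius acts factor by factor: the cross term of each square is doubled and vanishes.
  euler² : ∀ x n → euler x n * euler x n ≈ euler (x * x) n
  euler² x zero    = *-identityˡ 1#
  euler² x (suc n) = begin
    e * (1# + p) * (e * (1# + p))
      ≈⟨ solve 2 (λ e p → e :* (con 1ℙ :+ p) :* (e :* (con 1ℙ :+ p)) := e :* e :* (con 1ℙ :+ p :* p)) ≈-refl e p ⟩
    e * e * (1# + p * p)
      ≈⟨ *-cong (euler² x n) (+-congˡ (≈-sym (≈-trans (^-square x (suc n)) (^-double x (suc n))))) ⟩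
    euler (x * x) n * (1# + (x * x) ^ suc n) ∎
    where
    e = euler x n
    p = x ^ suc n

  -- The exponents up to 2n are split by parity; passing to n + 1 adds the odd exponent 2n + 1 and
  -- the even one 2n + 2.
  eulerOdd*euler : ∀ x n → eulerOdd x n * euler (x * x) n ≈ euler x (2 ℕ.* n)
  eulerOdd*euler x zero    = *-identityˡ 1#
  eulerOdd*euler x (suc n) = begin
    o * (1# + a) * (e * (1# + (x * x) ^ suc n))
      ≈⟨ solve 4 (λ o a e b → o :* a :* (e :* b) := o :* e :* a :* b) ≈-refl o (1# + a) e _ ⟩
    o * e * (1# + a) * (1# + (x * x) ^ suc n)
      ≈⟨ *-cong (*-congʳ (eulerOdd*euler x n)) (+-congˡ (≈-trans (^-square x (suc n)) (^-congʳ x (ℕ.*-suc 2 n)))) ⟩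
    euler x (2 ℕ.+ 2 ℕ.* n)
      ≡⟨ cong (euler x) (ℕ.*-suc 2 n) ⟨
    euler x (2 ℕ.* suc n) ∎
    where
    o = eulerOdd x n
    a = x ^ suc (2 ℕ.* n)
    e = euler (x * x) n

  infix 4 _≈_[mod_]

  _≈_[mod_] : Carrier → Carrier → Carrier → Set _
  x ≈ y [mod z ] = ∃ λ w → x ≈ y + z * w

  -- Each factor past the first m is 1 modulo x^(m+1).
  euler-stable : ∀ x m d → euler x (d ℕ.+ m) ≈ euler x m [mod x ^ suc m ]
  euler-stable x m zero    = 0# , ≈-sym (≈-trans (+-congˡ (zeroʳ _)) (+-identityʳ _))
  euler-stable x m (suc d) with euler-stable x m d
  ... | w , eq = _ , (begin
    euler x (d ℕ.+ m) * (1# + x ^ suc (d ℕ.+ m))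
      ≈⟨ *-cong eq (+-congˡ (≈-trans (^-congʳ x (sym (ℕ.+-suc d m))) (^-homo-* x d (suc m)))) ⟩
    (e + z * w) * (1# + x ^ d * z)
      ≈⟨ solve 4 (λ e z w y → (e :+ z :* w) :* (con 1ℙ :+ y :* z)
                           := e :+ z :* (w :+ (e :+ z :* w) :* y)) ≈-refl e z w (x ^ d) ⟩
    e + z * (w + (e + z * w) * x ^ d) ∎)
    where
    e = euler x m
    z = x ^ suc m

  -- Shanks's finite form of Gauss's identity for ψ.

  module Shanks (q : Carrier) where

    -- ∏ (1 + q²ᵏ) over s < k ≤ s + d
    evens : ℕ → ℕ → Carrier
    evens s zero    = 1#
    evens s (suc d) = (1# + q ^ (2 ℕ.* suc s)) * evens (suc s) d

    -- The recursion of `evens` removes the smallest exponent, whereas comparing n + 1 with n at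
    -- fixed s needs the largest.
    evens-last : ∀ s d → evens s (suc d) ≈ evens s d * (1# + q ^ (2 ℕ.* suc (s ℕ.+ d)))
    evens-last s zero    = ≈-trans (*-comm _ _)
      (*-congˡ (+-congˡ (^-congʳ q (cong (λ k → 2 ℕ.* suc k) (sym (ℕ.+-identityʳ s))))))
    evens-last s (suc d) = begin
      a * evens (suc s) (suc d)
        ≈⟨ *-congˡ (evens-last (suc s) d) ⟩
      a * (evens (suc s) d * (1# + q ^ (2 ℕ.* suc (suc s ℕ.+ d))))
        ≈⟨ *-assoc _ _ _ ⟨
      evens s (suc d) * (1# + q ^ (2 ℕ.* suc (suc s ℕ.+ d)))
        ≈⟨ *-congˡ (+-congˡ (^-congʳ q (cong (λ k → 2 ℕ.* suc k) (sym (ℕ.+-suc s d))))) ⟩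
      evens s (suc d) * (1# + q ^ (2 ℕ.* suc (s ℕ.+ suc d))) ∎
      where a = 1# + q ^ (2 ℕ.* suc s)

    evens≈euler : ∀ n → evens 0 n ≈ euler (q * q) n
    evens≈euler zero    = ≈-refl
    evens≈euler (suc n) = ≈-trans (evens-last 0 n)
      (*-cong (evens≈euler n) (+-congˡ (≈-sym (^-square q (suc n)))))

    -- For n = s + d this is Shanks's summand (Pₙ / Pₛ) q^(s(2n+1)), where Pₙ = (-q²; q²)ₙ / (-q;
    -- q²)ₙ, cleared of the denominator (-q; q²)ₙ.
    term : ℕ → ℕ → Carrier
    term s d = evens s d * eulerOdd q s * q ^ (s ℕ.* suc (2 ℕ.* (s ℕ.+ d)))

    -- The sum of term t u over s ≤ t, t + u = s + d.
    terms : ℕ → ℕ → Carrier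
    terms s zero    = term s 0
    terms s (suc d) = term s (suc d) + terms (suc s) d

    -- The telescoped quantity: the right side of `telescope` at `s` and `suc d` equals
    -- `boundary (suc s) d`.
    boundary : ℕ → ℕ → Carrier
    boundary s d = (1# + q ^ (2 ℕ.* s)) * term s d

    -- The exponents are the triangular numbers of index 2n + 1 and 2n + 2.
    triangles : ℕ → Carrier
    triangles n = q ^ (suc n ℕ.* suc (2 ℕ.* n)) + q ^ (suc n ℕ.* suc (2 ℕ.* suc n))

    -- Summand by summand, the difference of Shanks's sums for n + 1 and n is
    -- a difference of consecutive boundary terms.
    telescope : ∀ s d →
      term s (suc d) + (1# + q ^ suc (2 ℕ.* (s ℕ.+ d))) * term s d + boundary s d ≈
      (1# + q ^ suc (2 ℕ.* s)) * q ^ suc (2 ℕ.* (s ℕ.+ d)) * term s d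
    telescope s d = begin
      evens s (suc d) * o * q ^ (s ℕ.* suc (2 ℕ.* (s ℕ.+ suc d))) + (1# + c) * (e * o * p) + (1# + a) * (e * o * p)
        ≈⟨ +-congʳ (+-congʳ (*-cong (*-congʳ (≈-trans (evens-last s d) (*-congˡ (+-congˡ (^-congʳ q (ℕ.*-suc 2 (s ℕ.+ d)))))))
             (≈-trans (^-congʳ q (lemma s d)) (^-homo-* q (s ℕ.* suc (2 ℕ.* (s ℕ.+ d))) (2 ℕ.* s))))) ⟩
      e * (1# + q * c) * o * (p * a) + (1# + c) * (e * o * p) + (1# + a) * (e * o * p)
        ≈⟨ solve 6 (λ e q c o p a →
             e :* (con 1ℙ :+ q :* c) :* o :* (p :* a) :+ (con 1ℙ :+ c) :* (e :* o :* p) :+ (con 1ℙ :+ a) :* (e :* o :* p)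
             := (con 1ℙ :+ q :* a) :* c :* (e :* o :* p)) ≈-refl e q c o p a ⟩
      (1# + q * a) * c * (e * o * p) ∎
      where
      e = evens s d
      o = eulerOdd q s
      a = q ^ (2 ℕ.* s)
      c = q ^ suc (2 ℕ.* (s ℕ.+ d))
      p = q ^ (s ℕ.* suc (2 ℕ.* (s ℕ.+ d)))
      lemma : ∀ s d → s ℕ.* suc (2 ℕ.* (s ℕ.+ suc d)) ≡ s ℕ.* suc (2 ℕ.* (s ℕ.+ d)) ℕ.+ 2 ℕ.* s
      lemma = solve-∀

    -- Induction on d with n = s + d fixed adds up `telescope`. Inner boundaries cancel; at the top
    -- s = n the remaining right side joins the new summand `term (suc n) 0`, and the two supply the
    -- two triangular powers.
    terms-step : ∀ s d →
      terms s (suc d) + (1# + q ^ suc (2 ℕ.* (s ℕ.+ d))) * terms s d + boundary s d ≈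
      eulerOdd q (suc (s ℕ.+ d)) * triangles (s ℕ.+ d)
    terms-step s zero = begin
      term s 1 + term (suc s) 0 + (1# + c) * term s 0 + boundary s 0
        ≈⟨ solve 4 (λ x y z w → x :+ y :+ z :+ w := x :+ z :+ w :+ y) ≈-refl _ _ _ _ ⟩
      term s 1 + (1# + c) * term s 0 + boundary s 0 + term (suc s) 0
        ≈⟨ +-congʳ (telescope s 0) ⟩
      (1# + q ^ suc (2 ℕ.* s)) * c * term s 0 + term (suc s) 0
        ≈⟨ +-cong (*-cong (*-congˡ (^-congʳ q c≡)) (*-congˡ (^-congʳ q p≡)))
                  (*-congˡ (^-congʳ q r≡)) ⟩
      (1# + h) * h * (1# * o * p) + 1# * (o * (1# + h)) * r
        ≈⟨ solve 4 (λ h o p r → (con 1ℙ :+ h) :* h :* (con 1ℙ :* o :* p) :+ con 1ℙ :* (o :* (con 1ℙ :+ h)) :* r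
                             := o :* (con 1ℙ :+ h) :* (h :* p :+ r)) ≈-refl h o p r ⟩
      o * (1# + h) * (h * p + r)
        ≈⟨ *-congˡ (+-congʳ (^-homo-* q (suc (2 ℕ.* s)) (s ℕ.* suc (2 ℕ.* s)))) ⟨
      eulerOdd q (suc s) * triangles s
        ≡⟨ cong (λ k → eulerOdd q (suc k) * triangles k) (ℕ.+-identityʳ s) ⟨
      eulerOdd q (suc (s ℕ.+ 0)) * triangles (s ℕ.+ 0) ∎
      where
      o = eulerOdd q s
      h = q ^ suc (2 ℕ.* s)
      c = q ^ suc (2 ℕ.* (s ℕ.+ 0))
      p = q ^ (s ℕ.* suc (2 ℕ.* s))
      r = q ^ (suc s ℕ.* suc (2 ℕ.* suc s))
      c≡ : suc (2 ℕ.* (s ℕ.+ 0)) ≡ suc (2 ℕ.* s)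
      c≡ = cong (λ k → suc (2 ℕ.* k)) (ℕ.+-identityʳ s)
      p≡ : s ℕ.* suc (2 ℕ.* (s ℕ.+ 0)) ≡ s ℕ.* suc (2 ℕ.* s)
      p≡ = cong (s ℕ.*_) c≡
      r≡ : suc s ℕ.* suc (2 ℕ.* (suc s ℕ.+ 0)) ≡ suc s ℕ.* suc (2 ℕ.* suc s)
      r≡ = cong (λ k → suc s ℕ.* suc (2 ℕ.* suc k)) (ℕ.+-identityʳ s)
    terms-step s (suc d) = begin
      term s (suc (suc d)) + terms (suc s) (suc d) + (1# + c) * (term s (suc d) + terms (suc s) d) + boundary s (suc d)
        ≈⟨ solve 6 (λ x y z t u v → x :+ y :+ z :* (t :+ u) :+ v := (x :+ z :* t :+ v) :+ (y :+ z :* u)) ≈-refl _ _ _ _ _ _ ⟩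
      (term s (suc (suc d)) + (1# + c) * term s (suc d) + boundary s (suc d)) + (terms (suc s) (suc d) + (1# + c) * terms (suc s) d)
        ≈⟨ +-cong (≈-trans (telescope s (suc d)) boundary-suc) (+-congˡ (*-congʳ (+-congˡ (^-congʳ q c≡)))) ⟩
      boundary (suc s) d + (terms (suc s) (suc d) + (1# + q ^ suc (2 ℕ.* (suc s ℕ.+ d))) * terms (suc s) d)
        ≈⟨ +-comm _ _ ⟩
      terms (suc s) (suc d) + (1# + q ^ suc (2 ℕ.* (suc s ℕ.+ d))) * terms (suc s) d + boundary (suc s) d
        ≈⟨ terms-step (suc s) d ⟩
      eulerOdd q (suc (suc s ℕ.+ d)) * triangles (suc s ℕ.+ d)
        ≡⟨ cong (λ k → eulerOdd q (suc k) * triangles k) (ℕ.+-suc s d) ⟨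
      eulerOdd q (suc (s ℕ.+ suc d)) * triangles (s ℕ.+ suc d) ∎
      where
      c = q ^ suc (2 ℕ.* (s ℕ.+ suc d))
      c≡ : suc (2 ℕ.* (s ℕ.+ suc d)) ≡ suc (2 ℕ.* (suc s ℕ.+ d))
      c≡ = cong (λ k → suc (2 ℕ.* k)) (ℕ.+-suc s d)
      boundary-suc : (1# + q ^ suc (2 ℕ.* s)) * c * term s (suc d) ≈ boundary (suc s) d
      boundary-suc = begin
        h * c * (a * e * o * q ^ (s ℕ.* k))
          ≈⟨ solve 6 (λ h c a e o p → h :* c :* (a :* e :* o :* p) := a :* (e :* (o :* h) :* (c :* p))) ≈-refl h c a e o _ ⟩
        a * (e * (o * h) * (c * q ^ (s ℕ.* k)))
          ≈⟨ *-congˡ (*-congˡ (^-homo-* q k (s ℕ.* k))) ⟨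
        a * (e * (o * h) * q ^ (suc s ℕ.* k))
          ≈⟨ *-congˡ (*-congˡ (^-congʳ q (cong (suc s ℕ.*_) c≡))) ⟩
        boundary (suc s) d ∎
        where
        k = suc (2 ℕ.* (s ℕ.+ suc d))
        a = 1# + q ^ (2 ℕ.* suc s)
        h = 1# + q ^ suc (2 ℕ.* s)
        e = evens (suc s) d
        o = eulerOdd q s

    -- The partial sum of ψ up to the exponent 2n(2n+1)/2.
    theta : ℕ → Carrier
    theta zero    = 1#
    theta (suc n) = theta n + triangles n

    shanks : ∀ n → eulerOdd q n * theta n ≈ terms 0 n
    shanks zero    = solve 0 (con 1ℙ :* con 1ℙ := con 1ℙ :* con 1ℙ :* con 1ℙ) ≈-refl
    shanks (suc n) = begin
      o * (1# + c) * (theta n + triangles n)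
        ≈⟨ solve 4 (λ o c t r → o :* c :* (t :+ r) := c :* (o :* t) :+ o :* c :* r) ≈-refl o (1# + c) _ _ ⟩
      (1# + c) * (o * theta n) + o * (1# + c) * triangles n
        ≈⟨ +-cong (*-congˡ (shanks n)) (≈-sym (terms-step 0 n)) ⟩
      (1# + c) * terms 0 n + (terms 0 (suc n) + (1# + c) * terms 0 n + (1# + 1#) * term 0 n)
        -- The boundary at s = 0 has the factor 1 + q⁰ = 1 + 1, so it vanishes.
        ≈⟨ solve 3 (λ x y z → x :+ (y :+ x :+ (con 1ℙ :+ con 1ℙ) :* z) := y) ≈-refl _ _ _ ⟩
      terms 0 (suc n) ∎
      where
      o = eulerOdd q n
      c = q ^ suc (2 ℕ.* n)

    -- A summand of index s ≥ 1 has the factor q^(s(2n+1)), so modulo q^(2n+1) only the summand of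
    -- index 0 survives.
    terms-suc≈0 : ∀ s d → ∃ λ w → terms (suc s) d ≈ q ^ suc (2 ℕ.* (suc s ℕ.+ d)) * w
    term-suc≈0  : ∀ s d → ∃ λ w → term (suc s) d ≈ q ^ suc (2 ℕ.* (suc s ℕ.+ d)) * w
    term-suc≈0 s d = _ , (begin
      x * q ^ (k ℕ.+ s ℕ.* k)         ≈⟨ *-congˡ (^-homo-* q k (s ℕ.* k)) ⟩
      x * (q ^ k * q ^ (s ℕ.* k))     ≈⟨ solve 3 (λ x y z → x :* (y :* z) := y :* (x :* z)) ≈-refl x _ _ ⟩
      q ^ k * (x * q ^ (s ℕ.* k))     ∎)
      where
      k = suc (2 ℕ.* (suc s ℕ.+ d))
      x = evens (suc s) d * eulerOdd q (suc s)
    terms-suc≈0 s zero    = term-suc≈0 s zero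
    terms-suc≈0 s (suc d) with term-suc≈0 s (suc d) | terms-suc≈0 (suc s) d
    ... | v , eq | w , eq′ = v + w , (begin
      term (suc s) (suc d) + terms (suc (suc s)) d
        ≈⟨ +-cong eq (≈-trans eq′ (*-congʳ (^-congʳ q (cong (λ k → suc (2 ℕ.* suc k)) (sym (ℕ.+-suc s d)))))) ⟩
      z * v + z * w   ≈⟨ distribˡ z v w ⟨
      z * (v + w)     ∎)
      where z = q ^ suc (2 ℕ.* (suc s ℕ.+ suc d))

    terms≈euler : ∀ n → terms 0 n ≈ euler (q * q) n [mod q ^ suc (2 ℕ.* n) ]
    terms≈euler zero = 0# , solve 1 (λ z → con 1ℙ :* con 1ℙ :* con 1ℙ := con 1ℙ :+ z :* con 0ℙ) ≈-refl _
    terms≈euler (suc n) with terms-suc≈0 0 n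
    ... | w , eq = w , +-cong
      (≈-trans (≈-trans (*-identityʳ _) (*-identityʳ _)) (evens≈euler (suc n))) eq

    eulerOdd*theta : ∀ n → eulerOdd q n * theta n ≈ euler (q * q) n [mod q ^ suc (2 ℕ.* n) ]
    eulerOdd*theta n with terms≈euler n
    ... | w , eq = w , ≈-trans (shanks n) eq

    -- Multiplied by (-q⁴; q⁴)ₘ, both sides become congruent to f (-q⁴; q⁴)ₘ.
    theta≈inverse : ∀ m f →
      eulerOdd q (2 ℕ.* m) * eulerOdd (q * q) m * f ≈ 1# →
      let e = euler (q * q * (q * q)) m in
      e * theta (2 ℕ.* m) ≈ e * f [mod q ^ suc (2 ℕ.* (2 ℕ.* m)) ]
    theta≈inverse m f inv with eulerOdd*theta (2 ℕ.* m) | euler-stable (q * q * (q * q)) m m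
    ... | v , eq | w , eq′ = _ , (begin
      e * t
        ≈⟨ *-identityˡ _ ⟨
      1# * (e * t)
        -- Writing 1 as a h f lets h meet e in Euler's factorisation and a meet t in Shanks's
        -- identity.
        ≈⟨ *-congʳ inv ⟨
      a * h * f * (e * t)
        ≈⟨ solve 5 (λ a h f e t → a :* h :* f :* (e :* t) := f :* (h :* e) :* (a :* t)) ≈-refl a h f e t ⟩
      f * (h * e) * (a * t)
        ≈⟨ *-cong (*-congˡ (eulerOdd*euler (q * q) m)) eq ⟩
      f * g * (g + z * v)
        ≈⟨ solve 4 (λ f g z v → f :* g :* (g :+ z :* v) := f :* (g :* g) :+ z :* (f :* g :* v)) ≈-refl f g z v ⟩
      f * (g * g) + z * (f * g * v)
        ≈⟨ +-congʳ (*-congˡ g²) ⟩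
      f * (e + q * (q * (q * z)) * w) + z * (f * g * v)
        ≈⟨ solve 7 (λ f e q z w g v → f :* (e :+ q :* (q :* (q :* z)) :* w) :+ z :* (f :* g :* v)
                    := e :* f :+ z :* (f :* q :* q :* q :* w :+ f :* g :* v)) ≈-refl f e q z w g v ⟩
      e * f + z * (f * q * q * q * w + f * g * v) ∎)
      where
      e = euler (q * q * (q * q)) m
      t = theta (2 ℕ.* m)
      a = eulerOdd q (2 ℕ.* m)
      h = eulerOdd (q * q) m
      g = euler (q * q) (2 ℕ.* m)
      z = q ^ suc (2 ℕ.* (2 ℕ.* m))
      -- The remainder of `euler-stable` at q⁴ begins at q^(4m+4), three powers beyond z.
      y^ : (q * q * (q * q)) ^ suc m ≈ q * (q * (q * z))
      y^ = begin
        (q * q * (q * q)) ^ suc m    ≈⟨ ^-square (q * q) (suc m) ⟩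
        (q * q) ^ (2 ℕ.* suc m)      ≈⟨ ^-square q (2 ℕ.* suc m) ⟩
        q ^ (2 ℕ.* (2 ℕ.* suc m))    ≈⟨ ^-congʳ q (lemma m) ⟩
        q * (q * (q * z))            ∎
        where
        lemma : ∀ m → 2 ℕ.* (2 ℕ.* suc m) ≡ 3 ℕ.+ suc (2 ℕ.* (2 ℕ.* m))
        lemma = solve-∀
      g² : g * g ≈ e + q * (q * (q * z)) * w
      g² = begin
        g * g                                    ≈⟨ euler² (q * q) (2 ℕ.* m) ⟩
        euler (q * q * (q * q)) (2 ℕ.* m)        ≡⟨ cong (λ k → euler (q * q * (q * q)) (m ℕ.+ k)) (ℕ.+-identityʳ m) ⟩
        euler (q * q * (q * q)) (m ℕ.+ m)        ≈⟨ eq′ ⟩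
        e + (q * q * (q * q)) ^ suc m * w        ≈⟨ +-congˡ (*-congʳ y^) ⟩
        e + q * (q * (q * z)) * w                ∎

-- The ring of formal power series over the two-element field.

module Series where
  -- Data.Parity gives _+_ the precedence of _*_.
  open import Data.Parity using (_*_) renaming (_+_ to infixl 6 _+_)
  open Algebra.Properties.CommutativeSemigroup ℙ.+-commutativeSemigroup using (interchange; x∙yz≈y∙xz)

  infixl 6 _⊕_
  infixl 7 _⊛_

  Series : Set
  Series = ℕ → Parity

  0ˢ 1ˢ q : Series
  0ˢ _ = 0ℙ
  1ˢ zero    = 1ℙ
  1ˢ (suc _) = 0ℙ
  q zero    = 0ℙ
  q (suc n) = 1ˢ n

  -- The Cauchy product, by recursion on the first factor. The tail of f ⊛ g is by computation
  -- `scale (f 0) (g ∘ suc) ⊕ (f ∘ suc ⊛ g)`, which turns the ring laws into inductions on the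
  -- coefficient.
  _⊕_ _⊛_ : Series → Series → Series
  (f ⊕ g) n = f n + g n
  (f ⊛ g) zero    = f 0 * g 0
  (f ⊛ g) (suc n) = f 0 * g (suc n) + (f ∘ suc ⊛ g) n

  scale : Parity → Series → Series
  scale c f n = c * f n

  ⊛-cong : ∀ {f f′ g g′} → f ≗ f′ → g ≗ g′ → f ⊛ g ≗ f′ ⊛ g′
  ⊛-cong f≗ g≗ zero    = cong₂ _*_ (f≗ 0) (g≗ 0)
  ⊛-cong f≗ g≗ (suc n) =
    cong₂ _+_ (cong₂ _*_ (f≗ 0) (g≗ (suc n))) (⊛-cong (f≗ ∘ suc) g≗ n)

  ⊛-distribʳ : ∀ h f g → (f ⊕ g) ⊛ h ≗ (f ⊛ h) ⊕ (g ⊛ h)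
  ⊛-distribʳ h f g zero    = ℙ.*-distribʳ-+ (h 0) (f 0) (g 0)
  ⊛-distribʳ h f g (suc n) = trans
    (cong₂ _+_ (ℙ.*-distribʳ-+ (h (suc n)) (f 0) (g 0)) (⊛-distribʳ h (f ∘ suc) (g ∘ suc) n))
    (interchange (f 0 * h (suc n)) _ _ _)

  scale-⊛ : ∀ c f g → scale c f ⊛ g ≗ scale c (f ⊛ g)
  scale-⊛ c f g zero    = ℙ.*-assoc c (f 0) (g 0)
  scale-⊛ c f g (suc n) = trans
    (cong₂ _+_ (ℙ.*-assoc c (f 0) _) (scale-⊛ c (f ∘ suc) g n))
    (sym (ℙ.*-distribˡ-+ c _ _))

  ⊛-assoc : ∀ f g h → (f ⊛ g) ⊛ h ≗ f ⊛ (g ⊛ h)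
  ⊛-assoc f g h zero    = ℙ.*-assoc (f 0) (g 0) (h 0)
  ⊛-assoc f g h (suc n) = begin
    f 0 * g 0 * h (suc n) + ((scale (f 0) (g ∘ suc) ⊕ (f ∘ suc ⊛ g)) ⊛ h) n
      ≡⟨ cong₂ _+_ (ℙ.*-assoc (f 0) _ _) (⊛-distribʳ h (scale (f 0) (g ∘ suc)) (f ∘ suc ⊛ g) n) ⟩
    f 0 * (g 0 * h (suc n)) + ((scale (f 0) (g ∘ suc) ⊛ h) n + ((f ∘ suc ⊛ g) ⊛ h) n)
      ≡⟨ cong₂ (λ x y → f 0 * (g 0 * h (suc n)) + (x + y)) (scale-⊛ (f 0) (g ∘ suc) h n) (⊛-assoc (f ∘ suc) g h n) ⟩
    f 0 * (g 0 * h (suc n)) + (f 0 * (g ∘ suc ⊛ h) n + (f ∘ suc ⊛ (g ⊛ h)) n)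
      ≡⟨ ℙ.+-assoc (f 0 * (g 0 * h (suc n))) _ _ ⟨
    f 0 * (g 0 * h (suc n)) + f 0 * (g ∘ suc ⊛ h) n + (f ∘ suc ⊛ (g ⊛ h)) n
      ≡⟨ cong (_+ (f ∘ suc ⊛ (g ⊛ h)) n) (ℙ.*-distribˡ-+ (f 0) (g 0 * h (suc n)) _) ⟨
    (f ⊛ (g ⊛ h)) (suc n) ∎
    where open ≡-Reasoning

  -- The mirror image of the defining recursion, needed for commutativity.
  ⊛-sucʳ : ∀ f g n → (f ⊛ g) (suc n) ≡ f (suc n) * g 0 + (f ⊛ (g ∘ suc)) n
  ⊛-sucʳ f g zero    = ℙ.+-comm (f 0 * g 1) (f 1 * g 0)
  ⊛-sucʳ f g (suc n) = begin
    f 0 * g (2 ℕ.+ n) + (f ∘ suc ⊛ g) (suc n)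
      ≡⟨ cong (f 0 * g (2 ℕ.+ n) +_) (⊛-sucʳ (f ∘ suc) g n) ⟩
    f 0 * g (2 ℕ.+ n) + (f (2 ℕ.+ n) * g 0 + (f ∘ suc ⊛ g ∘ suc) n)
      ≡⟨ x∙yz≈y∙xz (f 0 * g (2 ℕ.+ n)) (f (2 ℕ.+ n) * g 0) _ ⟩
    f (2 ℕ.+ n) * g 0 + (f ⊛ g ∘ suc) (suc n) ∎
    where open ≡-Reasoning

  ⊛-comm : ∀ f g → f ⊛ g ≗ g ⊛ f
  ⊛-comm f g zero    = ℙ.*-comm (f 0) (g 0)
  ⊛-comm f g (suc n) = trans (⊛-sucʳ f g n)
    (cong₂ _+_ (ℙ.*-comm (f (suc n)) (g 0)) (⊛-comm f (g ∘ suc) n))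

  ⊛-zeroˡ : ∀ f → 0ˢ ⊛ f ≗ 0ˢ
  ⊛-zeroˡ f zero    = refl
  ⊛-zeroˡ f (suc n) = ⊛-zeroˡ f n

  ⊛-identityˡ : ∀ f → 1ˢ ⊛ f ≗ f
  ⊛-identityˡ f zero    = refl
  ⊛-identityˡ f (suc n) = trans (cong (f (suc n) +_) (⊛-zeroˡ f n)) (ℙ.+-identityʳ (f (suc n)))

  𝔽₂[[q]] : CommutativeRing 0ℓ 0ℓ
  𝔽₂[[q]] = record
    { Carrier = Series
    ; _≈_ = _≗_
    ; _+_ = _⊕_
    ; _*_ = _⊛_
    ; -_  = id
    ; 0#  = 0ˢ
    ; 1#  = 1ˢ
    ; isCommutativeRing = record
      { isRing = record
        { +-isAbelianGroup = record
          { isGroup = record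
            { isMonoid = record
              { isSemigroup = record
                { isMagma = record
                  { isEquivalence = record
                    { refl = λ _ → refl ; sym = λ e → sym ∘ e ; trans = λ d e n → trans (d n) (e n) }
                  ; ∙-cong = λ d e n → cong₂ _+_ (d n) (e n)
                  }
                ; assoc = λ f g h n → ℙ.+-assoc (f n) (g n) (h n)
                }
              ; identity = (λ f n → refl) , (λ f n → ℙ.+-identityʳ (f n))
              }
            ; inverse = (λ f n → ℙ.p+p≡0ℙ (f n)) , (λ f n → ℙ.p+p≡0ℙ (f n))
            ; ⁻¹-cong = id
            }
          ; comm = λ f g n → ℙ.+-comm (f n) (g n)
          }
        ; *-cong = ⊛-cong
        ; *-assoc = ⊛-assoc
        ; *-identity = ⊛-identityˡ , λ f n → trans (⊛-comm f 1ˢ n) (⊛-identityˡ f n)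
        ; distrib = (λ h f g n → trans (⊛-comm h (f ⊕ g) n) (trans (⊛-distribʳ h f g n)
                      (cong₂ _+_ (⊛-comm f h n) (⊛-comm g h n))))
                  , ⊛-distribʳ
        }
      ; *-comm = ⊛-comm
      }
    }

  module 𝔽₂[[q]] = CommutativeRing 𝔽₂[[q]]

  open Algebra.Properties.Semiring.Exp 𝔽₂[[q]].semiring public using (_^_)

  open Characteristic2 𝔽₂[[q]] (λ n → ℙ.p+p≡0ℙ (1ˢ n)) public
  open Shanks q public

  -- Coefficients of shifted series and cancellation of units.

  -- Multiplication by q shifts by one place, because the tail of `q` is `1ˢ`.
  q^-< : ∀ k f {n} → n ℕ.< k → (q ^ k ⊛ f) n ≡ 0ℙ
  q^-< (suc k) f {n} n<k = trans (⊛-assoc q (q ^ k) f n) (shift n n<k)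
    where
    shift : ∀ n → n ℕ.< suc k → (q ⊛ (q ^ k ⊛ f)) n ≡ 0ℙ
    shift zero    _         = refl
    shift (suc n) (s≤s n<k) = trans (⊛-identityˡ (q ^ k ⊛ f) n) (q^-< k f n<k)

  q^-+ : ∀ k f n → (q ^ k ⊛ f) (k ℕ.+ n) ≡ f n
  q^-+ zero    f n = ⊛-identityˡ f n
  q^-+ (suc k) f n = trans (⊛-assoc q (q ^ k) f (suc k ℕ.+ n))
    (trans (⊛-identityˡ (q ^ k ⊛ f) (k ℕ.+ n)) (q^-+ k f n))

  q^-≡ : ∀ k → (q ^ k) k ≡ 1ℙ
  q^-≡ zero    = refl
  q^-≡ (suc k) = trans (⊛-identityˡ (q ^ k) k) (q^-≡ k)

  q^-≢ : ∀ k n → k ≢ n → (q ^ k) n ≡ 0ℙ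
  q^-≢ zero    zero    0≢0 = contradiction refl 0≢0
  q^-≢ zero    (suc n) _   = refl
  q^-≢ (suc k) zero    _   = refl
  q^-≢ (suc k) (suc n) k≢n = trans (⊛-identityˡ (q ^ k) n) (q^-≢ k n (k≢n ∘ cong suc))

  -- The lowest coefficient f(0) u(0) forces f(0) = 0; then the tail of f satisfies the hypothesis
  -- with n lowered by one. Only coefficients up to n are consulted, so knowledge modulo a power of
  -- q suffices.
  cancel-unit : ∀ {u} → u 0 ≡ 1ℙ → ∀ f {n} →
                (∀ {k} → k ℕ.≤ n → (f ⊛ u) k ≡ 0ℙ) → f n ≡ 0ℙ
  cancel-unit {u} u₀ f {zero}  fu≡0 = begin
    f 0          ≡⟨ ℙ.*-identityʳ (f 0) ⟨
    f 0 * 1ℙ     ≡⟨ cong (f 0 *_) u₀ ⟨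
    f 0 * u 0    ≡⟨ fu≡0 z≤n ⟩
    0ℙ           ∎
    where open ≡-Reasoning
  cancel-unit {u} u₀ f {suc n} fu≡0 = cancel-unit {u} u₀ (f ∘ suc) λ {k} k≤n → begin
    (f ∘ suc ⊛ u) k                            ≡⟨⟩
    0ℙ * u (suc k) + (f ∘ suc ⊛ u) k           ≡⟨ cong (λ x → x * u (suc k) + (f ∘ suc ⊛ u) k) f₀ ⟨
    (f ⊛ u) (suc k)                            ≡⟨ fu≡0 (s≤s k≤n) ⟩
    0ℙ                                         ∎
    where
    open ≡-Reasoning
    f₀ : f 0 ≡ 0ℙ
    f₀ = cancel-unit {u} u₀ f {zero} λ { z≤n → fu≡0 z≤n }

  cancel-unit-mod : ∀ {u f g N} → u 0 ≡ 1ℙ → u ⊛ f ≈ u ⊛ g [mod q ^ N ] →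
                    ∀ {n} → n ℕ.< N → f n ≡ g n
  cancel-unit-mod {u} {f} {g} {N} u₀ (w , eq) {n} n<N = ℙ-eq (f n) (g n)
    (cancel-unit {u} u₀ (f ⊕ g) λ {k} k≤n → begin
      ((f ⊕ g) ⊛ u) k
        ≡⟨ solve 3 (λ f g u → (f :+ g) :* u := u :* f :+ u :* g) (λ _ → refl) f g u k ⟩
      (u ⊛ f) k + (u ⊛ g) k
        ≡⟨ cong (_+ (u ⊛ g) k) (eq k) ⟩
      (u ⊛ g) k + (q ^ N ⊛ w) k + (u ⊛ g) k
        ≡⟨ cong (λ x → (u ⊛ g) k + x + (u ⊛ g) k) (q^-< N w (ℕ.≤-<-trans k≤n n<N)) ⟩
      (u ⊛ g) k + 0ℙ + (u ⊛ g) k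
        ≡⟨ cong (_+ (u ⊛ g) k) (ℙ.+-identityʳ ((u ⊛ g) k)) ⟩
      (u ⊛ g) k + (u ⊛ g) k
        ≡⟨ ℙ.p+p≡0ℙ ((u ⊛ g) k) ⟩
      0ℙ ∎)
    where
    open ≡-Reasoning
    open Solver using (solve; _:+_; _:*_; _:=_)
    ℙ-eq : ∀ a b → a + b ≡ 0ℙ → a ≡ b
    ℙ-eq 0ℙ b e = sym e
    ℙ-eq 1ℙ 1ℙ e = refl

  euler-0 : ∀ {x} n → x 0 ≡ 0ℙ → euler x n 0 ≡ 1ℙ
  euler-0 zero    x₀ = refl
  euler-0 {x} (suc n) x₀ rewrite euler-0 {x} n x₀ | x₀ = refl

-- Recurrences for partitions with bounded parts.

concatMap-applyUpTo-suc : ∀ {a} {A : Set a} (f : ℕ → List A) n →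
  concatMap f (applyUpTo suc n) ≡ concatMap (f ∘ suc) (upTo n)
concatMap-applyUpTo-suc f n = trans (cong (concatMap f) (sym (List.map-upTo suc n)))
  (List.concatMap-map f suc (upTo n))

partitions≤-< : ∀ k n → n ℕ.< suc k → partitions≤ (suc k) n ≡ partitions≤ k n
partitions≤-< k n n<k rewrite m<n⇒m/n≡0 n<k =
  trans (List.++-identityʳ _) (List.map-id (partitions≤ k n))

-- Multiplicity 0 of the part k + 1 gives the first list. From a positive multiplicity one copy is
-- removed, which leaves a partition of n.
partitions≤-+ : ∀ k n → partitions≤ (suc k) (suc k ℕ.+ n) ≡
  partitions≤ k (suc k ℕ.+ n) ++ map (suc k ∷_) (partitions≤ (suc k) n)
partitions≤-+ k n = begin
  concatMap f (upTo (suc ((suc k ℕ.+ n) / suc k)))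
    ≡⟨ cong (λ M → concatMap f (upTo (suc M))) quotient ⟩
  f 0 ++ concatMap f (applyUpTo suc (suc (n / suc k)))
    ≡⟨ cong₂ _++_ (List.map-id (partitions≤ k (suc k ℕ.+ n))) (concatMap-applyUpTo-suc f (suc (n / suc k))) ⟩
  partitions≤ k (suc k ℕ.+ n) ++ concatMap (f ∘ suc) (upTo (suc (n / suc k)))
    ≡⟨ cong (partitions≤ k (suc k ℕ.+ n) ++_) (List.concatMap-cong f-suc (upTo (suc (n / suc k)))) ⟩
  partitions≤ k (suc k ℕ.+ n) ++ concatMap (map (suc k ∷_) ∘ g) (upTo (suc (n / suc k)))
    ≡⟨ cong (partitions≤ k (suc k ℕ.+ n) ++_) (List.map-concatMap (suc k ∷_) g (upTo (suc (n / suc k)))) ⟨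
  partitions≤ k (suc k ℕ.+ n) ++ map (suc k ∷_) (partitions≤ (suc k) n) ∎
  where
  open ≡-Reasoning
  f g : ℕ → List (List ℕ)
  f m = map (replicate m (suc k) ++_) (partitions≤ k (suc k ℕ.+ n ℕ.∸ m ℕ.* suc k))
  g m = map (replicate m (suc k) ++_) (partitions≤ k (n ℕ.∸ m ℕ.* suc k))
  quotient : (suc k ℕ.+ n) / suc k ≡ suc (n / suc k)
  quotient = trans (+-distrib-/-∣ˡ n (∣-refl {suc k})) (cong (ℕ._+ n / suc k) (n/n≡1 (suc k)))
  f-suc : ∀ m → f (suc m) ≡ map (suc k ∷_) (g m)
  f-suc m = trans
    (cong (λ r → map (replicate (suc m) (suc k) ++_) (partitions≤ k r)) (ℕ.[m+n]∸[m+o]≡n∸o (suc k) n (m ℕ.* suc k)))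
    (List.map-∘ (partitions≤ k (n ℕ.∸ m ℕ.* suc k)))

b≤ : ℕ → ℕ → ℕ → ℕ
b≤ ℓ k n = length (filter (regular? ℓ) (partitions≤ k n))

length-filter-∷-∤ : ∀ {ℓ x} → ℓ ∤ x → ∀ xss →
  length (filter (regular? ℓ) (map (x ∷_) xss)) ≡ length (filter (regular? ℓ) xss)
length-filter-∷-∤ ℓ∤x []         = refl
length-filter-∷-∤ {ℓ} {x} ℓ∤x (xs ∷ xss) = step (P xs)
  where
  P = regular? ℓ
  ih = length-filter-∷-∤ ℓ∤x xss
  step : Dec (Regular ℓ xs) →
         length (filter P (map (x ∷_) (xs ∷ xss))) ≡ length (filter P (xs ∷ xss))
  step (yes r) = trans (cong length (List.filter-accept P {xs = map (x ∷_) xss} (ℓ∤x ∷ r)))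
    (trans (cong suc ih) (cong length (sym (List.filter-accept P {xs = xss} r))))
  step (no ¬r) = trans (cong length (List.filter-reject P {x = x ∷ xs} {xs = map (x ∷_) xss} λ { (_ ∷ r) → ¬r r }))
    (trans ih (cong length (sym (List.filter-reject P {xs = xss} ¬r))))

length-filter-∷-∣ : ∀ {ℓ x} → ℓ ∣ x → ∀ xss →
  length (filter (regular? ℓ) (map (x ∷_) xss)) ≡ 0
length-filter-∷-∣ ℓ∣x []         = refl
length-filter-∷-∣ {ℓ} {x} ℓ∣x (xs ∷ xss) =
  trans (cong length (List.filter-reject (regular? ℓ) {x = x ∷ xs} {xs = map (x ∷_) xss} λ { (ℓ∤x ∷ _) → ℓ∤x ℓ∣x }))
        (length-filter-∷-∣ ℓ∣x xss)

b≤-< : ∀ ℓ k n → n ℕ.< suc k → b≤ ℓ (suc k) n ≡ b≤ ℓ k n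
b≤-< ℓ k n n<k = cong (length ∘ filter (regular? ℓ)) (partitions≤-< k n n<k)

b≤-+ : ∀ ℓ k n → b≤ ℓ (suc k) (suc k ℕ.+ n) ≡
  b≤ ℓ k (suc k ℕ.+ n) ℕ.+ length (filter (regular? ℓ) (map (suc k ∷_) (partitions≤ (suc k) n)))
b≤-+ ℓ k n = begin
  length (filter P (partitions≤ (suc k) (suc k ℕ.+ n)))
    ≡⟨ cong (length ∘ filter P) (partitions≤-+ k n) ⟩
  length (filter P (partitions≤ k (suc k ℕ.+ n) ++ map (suc k ∷_) (partitions≤ (suc k) n)))
    ≡⟨ cong length (List.filter-++ P (partitions≤ k (suc k ℕ.+ n)) _) ⟩
  length (filter P (partitions≤ k (suc k ℕ.+ n)) ++ filter P (map (suc k ∷_) (partitions≤ (suc k) n)))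
    ≡⟨ List.length-++ (filter P (partitions≤ k (suc k ℕ.+ n))) ⟩
  b≤ ℓ k (suc k ℕ.+ n) ℕ.+ length (filter P (map (suc k ∷_) (partitions≤ (suc k) n))) ∎
  where
  open ≡-Reasoning
  P = regular? ℓ

-- Counting triangular numbers of bounded index.

-- Unlike in `ψ`, the search bound does not depend on n, so for fixed `M` the counts are the
-- coefficients of a partial sum of ψ.
triangular-count : ℕ → ℕ → ℕ
triangular-count M n = length (filter (λ k → triangular k ℕ.≟ n) (upTo M))

triangular-count-suc : ∀ M n → triangular-count (suc M) n ≡
  triangular-count M n ℕ.+ length (filter (λ k → triangular k ℕ.≟ n) (M ∷ []))
triangular-count-suc M n = begin
  length (filter P (upTo (suc M)))                            ≡⟨ cong (length ∘ filter P) (List.upTo-∷ʳ M) ⟨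
  length (filter P (upTo M ++ M ∷ []))                        ≡⟨ cong length (List.filter-++ P (upTo M) _) ⟩
  length (filter P (upTo M) ++ filter P (M ∷ []))             ≡⟨ List.length-++ (filter P (upTo M)) ⟩
  length (filter P (upTo M)) ℕ.+ length (filter P (M ∷ []))   ∎
  where
  open ≡-Reasoning
  P = λ k → triangular k ℕ.≟ n

triangular-count-≡ : ∀ M → triangular-count (suc M) (triangular M) ≡ suc (triangular-count M (triangular M))
triangular-count-≡ M = trans (triangular-count-suc M _)
  (trans (cong (λ xs → triangular-count M (triangular M) ℕ.+ length xs) (List.filter-accept (λ k → triangular k ℕ.≟ triangular M) {x = M} {xs = []} refl))
         (ℕ.+-comm _ 1))

triangular-count-≢ : ∀ M n → triangular M ≢ n → triangular-count (suc M) n ≡ triangular-count M n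
triangular-count-≢ M n T≢n = trans (triangular-count-suc M n)
  (trans (cong (λ xs → triangular-count M n ℕ.+ length xs) (List.filter-reject (λ k → triangular k ℕ.≟ n) {x = M} {xs = []} T≢n))
         (ℕ.+-identityʳ _))

triangular-count-stable : ∀ n d → triangular-count (d ℕ.+ suc n) n ≡ ψ n
triangular-count-stable n zero    = refl
triangular-count-stable n (suc d) = trans
  (triangular-count-≢ (d ℕ.+ suc n) n (ℕ.>⇒≢ (ℕ.<-≤-trans (ℕ.m≤n+m (suc n) d) (triangular-≥ (d ℕ.+ suc n)))))
  (triangular-count-stable n d)

-- The generating function of b₄ modulo 2 and its comparison with ψ.

module SeriesOfRegularPartitions where
  open Series
  open import Data.Parity using (_*_) renaming (_+_ to infixl 6 _+_)

  bˢ : ℕ → ℕ → Series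
  bˢ ℓ k n = parity (b≤ ℓ k n)

  <⊎+ : ∀ k n → n ℕ.< k ⊎ ∃ λ m → n ≡ k ℕ.+ m
  <⊎+ k n with ℕ.<-≤-connex n k
  ... | inj₁ n<k = inj₁ n<k
  ... | inj₂ k≤n = inj₂ (n ℕ.∸ k , sym (ℕ.m+[n∸m]≡n k≤n))

  bˢ-∣ : ∀ {ℓ} k → ℓ ∣ suc k → bˢ ℓ k ≗ bˢ ℓ (suc k)
  bˢ-∣ {ℓ} k ℓ∣k n with <⊎+ (suc k) n
  ... | inj₁ n<k = cong parity (sym (b≤-< ℓ k n n<k))
  ... | inj₂ (m , refl) = cong parity (sym (trans (b≤-+ ℓ k m)
    (trans (cong (b≤ ℓ k (suc k ℕ.+ m) ℕ.+_) (length-filter-∷-∣ ℓ∣k (partitions≤ (suc k) m))) (ℕ.+-identityʳ _))))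

  -- Splitting off one part k + 1 gives F(k+1) = F(k) + q^(k+1) F(k+1); this is solved for F(k),
  -- with minus read as plus.
  bˢ-∤ : ∀ {ℓ} k → ℓ ∤ suc k → bˢ ℓ k ≗ (1ˢ ⊕ q ^ suc k) ⊛ bˢ ℓ (suc k)
  bˢ-∤ {ℓ} k ℓ∤k n = sym (trans (⊛-distribʳ (bˢ ℓ (suc k)) 1ˢ (q ^ suc k) n)
    (trans (cong (_+ (q ^ suc k ⊛ bˢ ℓ (suc k)) n) (⊛-identityˡ (bˢ ℓ (suc k)) n)) (coefficient n)))
    where
    open ≡-Reasoning
    coefficient : ∀ n → bˢ ℓ (suc k) n + (q ^ suc k ⊛ bˢ ℓ (suc k)) n ≡ bˢ ℓ k n
    coefficient n with <⊎+ (suc k) n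
    ... | inj₁ n<k = trans (cong (bˢ ℓ (suc k) n +_) (q^-< (suc k) (bˢ ℓ (suc k)) n<k))
                     (trans (ℙ.+-identityʳ _) (cong parity (b≤-< ℓ k n n<k)))
    ... | inj₂ (m , refl) = begin
      bˢ ℓ (suc k) (suc k ℕ.+ m) + (q ^ suc k ⊛ bˢ ℓ (suc k)) (suc k ℕ.+ m)
        ≡⟨ cong₂ _+_ (cong parity (trans (b≤-+ ℓ k m) (cong (b≤ ℓ k (suc k ℕ.+ m) ℕ.+_) (length-filter-∷-∤ ℓ∤k (partitions≤ (suc k) m)))))
                     (q^-+ (suc k) (bˢ ℓ (suc k)) m) ⟩
      parity (b≤ ℓ k (suc k ℕ.+ m) ℕ.+ b≤ ℓ (suc k) m) + bˢ ℓ (suc k) m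
        ≡⟨ cong (_+ bˢ ℓ (suc k) m) (ℙ.+-homo-+ (b≤ ℓ k (suc k ℕ.+ m)) _) ⟩
      bˢ ℓ k (suc k ℕ.+ m) + bˢ ℓ (suc k) m + bˢ ℓ (suc k) m
        ≡⟨ ℙ.+-assoc (bˢ ℓ k (suc k ℕ.+ m)) _ _ ⟩
      bˢ ℓ k (suc k ℕ.+ m) + (bˢ ℓ (suc k) m + bˢ ℓ (suc k) m)
        ≡⟨ cong (bˢ ℓ k (suc k ℕ.+ m) +_) (ℙ.p+p≡0ℙ (bˢ ℓ (suc k) m)) ⟩
      bˢ ℓ k (suc k ℕ.+ m) + 0ℙ
        ≡⟨ ℙ.+-identityʳ _ ⟩
      bˢ ℓ k (suc k ℕ.+ m) ∎

  bˢ-stable : ∀ ℓ n d → bˢ ℓ (d ℕ.+ n) n ≡ bˢ ℓ n n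
  bˢ-stable ℓ n zero    = refl
  bˢ-stable ℓ n (suc d) = trans (cong parity (b≤-< ℓ (d ℕ.+ n) n (s≤s (ℕ.m≤n+m n d)))) (bˢ-stable ℓ n d)

  4∤ : ∀ m d → ¬ (4 ∣ suc d) → 4 ∤ suc (d ℕ.+ 4 ℕ.* m)
  4∤ m d 4∤d 4∣ = 4∤d (∣m+n∣m⇒∣n (subst (4 ∣_) (trans (cong suc (ℕ.+-comm d (4 ℕ.* m))) (sym (ℕ.+-suc (4 ℕ.* m) d))) 4∣) (m∣m*n m))

  -- Passing to m + 1 admits the parts 4m + 1 to 4m + 4. The odd ones give the two new factors of
  -- (-q; q²), the part 4m + 2 = 2(2m + 1) gives that of (-q²; q⁴), and the multiple of 4 changes
  -- nothing.
  bˢ₄-inverse : ∀ m → eulerOdd q (2 ℕ.* m) ⊛ eulerOdd (q ⊛ q) m ⊛ bˢ 4 (4 ℕ.* m) ≗ 1ˢ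
  bˢ₄-inverse zero    = λ { zero → refl ; (suc zero) → refl ; (suc (suc n)) → zeros n }
    where
    zeros : ∀ n → (1ˢ ⊛ 1ˢ ⊛ bˢ 4 0) (suc (suc n)) ≡ 0ℙ
    zeros n = trans (⊛-cong {g = bˢ 4 0} (⊛-identityˡ 1ˢ) (λ _ → refl) (suc (suc n))) (⊛-identityˡ (bˢ 4 0) (suc (suc n)))
  bˢ₄-inverse (suc m) = begin
    eulerOdd q (2 ℕ.* suc m) ⊛ (c ⊛ (1ˢ ⊕ (q ⊛ q) ^ suc (2 ℕ.* m))) ⊛ bˢ 4 (4 ℕ.* suc m)
      ≈⟨ *-cong (*-cong (reflexive (cong (eulerOdd q) (ℕ.*-suc 2 m)))
                        (*-congˡ {c} (+-congˡ {1ˢ} (trans′ (^-square q (suc (2 ℕ.* m))) (q^-cong (e₂ m))))))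
                (reflexive (cong (bˢ 4) (ℕ.*-suc 4 m))) ⟩
    a ⊛ (1ˢ ⊕ q ^ suc (2 ℕ.* (2 ℕ.* m))) ⊛ (1ˢ ⊕ q ^ suc (2 ℕ.* suc (2 ℕ.* m))) ⊛ (c ⊛ z) ⊛ bˢ 4 (4 ℕ.+ n)
      ≈⟨ *-congʳ {bˢ 4 (4 ℕ.+ n)} (*-congʳ {c ⊛ z} (*-cong (*-congˡ {a} (+-congˡ {1ˢ} (q^-cong (e₁ m)))) (+-congˡ {1ˢ} (q^-cong (e₃ m))))) ⟩
    a ⊛ x ⊛ y ⊛ (c ⊛ z) ⊛ bˢ 4 (4 ℕ.+ n)
      ≈⟨ solve 6 (λ a x y c z f → a :* x :* y :* (c :* z) :* f := a :* c :* (x :* (z :* (y :* f)))) (λ _ → refl) a x y c z _ ⟩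
    a ⊛ c ⊛ (x ⊛ (z ⊛ (y ⊛ bˢ 4 (4 ℕ.+ n))))
      ≈⟨ *-congˡ {a ⊛ c} (*-congˡ {x} (*-congˡ {z} (*-congˡ {y} (bˢ-∣ (3 ℕ.+ n) (subst (4 ∣_) (ℕ.*-suc 4 m) (m∣m*n (suc m))))))) ⟨
    a ⊛ c ⊛ (x ⊛ (z ⊛ (y ⊛ bˢ 4 (3 ℕ.+ n))))
      ≈⟨ *-congˡ {a ⊛ c} (*-congˡ {x} (*-congˡ {z} (bˢ-∤ (2 ℕ.+ n) (4∤ m 2 (from-no (4 ∣? 3)))))) ⟨
    a ⊛ c ⊛ (x ⊛ (z ⊛ bˢ 4 (2 ℕ.+ n)))
      ≈⟨ *-congˡ {a ⊛ c} (*-congˡ {x} (bˢ-∤ (1 ℕ.+ n) (4∤ m 1 (from-no (4 ∣? 2))))) ⟨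
    a ⊛ c ⊛ (x ⊛ bˢ 4 (1 ℕ.+ n))
      ≈⟨ *-congˡ {a ⊛ c} (bˢ-∤ n (4∤ m 0 (from-no (4 ∣? 1)))) ⟨
    a ⊛ c ⊛ bˢ 4 n
      ≈⟨ bˢ₄-inverse m ⟩
    1ˢ ∎
    where
    open 𝔽₂[[q]] using (*-cong; *-congˡ; *-congʳ; +-congˡ; setoid; reflexive) renaming (trans to trans′)
    open Relation.Binary.Reasoning.Setoid setoid
    open Solver using (solve; _:+_; _:*_; _:=_)
    q^-cong = λ {j k : ℕ} (e : j ≡ k) → reflexive (cong (q ^_) e)
    n = 4 ℕ.* m
    a = eulerOdd q (2 ℕ.* m)
    c = eulerOdd (q ⊛ q) m
    x = 1ˢ ⊕ q ^ suc n
    z = 1ˢ ⊕ q ^ (2 ℕ.+ n)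
    y = 1ˢ ⊕ q ^ (3 ℕ.+ n)
    e₁ : ∀ m → suc (2 ℕ.* (2 ℕ.* m)) ≡ suc (4 ℕ.* m)
    e₁ = solve-∀
    e₂ : ∀ m → 2 ℕ.* suc (2 ℕ.* m) ≡ 2 ℕ.+ 4 ℕ.* m
    e₂ = solve-∀
    e₃ : ∀ m → suc (2 ℕ.* suc (2 ℕ.* m)) ≡ 3 ℕ.+ 4 ℕ.* m
    e₃ = solve-∀

  parity-triangular-count-suc : ∀ M n →
    parity (triangular-count (suc M) n) ≡ parity (triangular-count M n) + (q ^ triangular M) n
  parity-triangular-count-suc M n with triangular M ℕ.≟ n
  ... | yes refl = begin
      parity (triangular-count (suc M) n)         ≡⟨ cong parity (trans (triangular-count-≡ M) (ℕ.+-comm 1 _)) ⟩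
      parity (triangular-count M n ℕ.+ 1)         ≡⟨ ℙ.+-homo-+ (triangular-count M n) 1 ⟩
      parity (triangular-count M n) + 1ℙ          ≡⟨ cong (parity (triangular-count M n) +_) (q^-≡ n) ⟨
      parity (triangular-count M n) + (q ^ n) n   ∎
    where open ≡-Reasoning
  ... | no T≢n = begin
      parity (triangular-count (suc M) n)                      ≡⟨ cong parity (triangular-count-≢ M n T≢n) ⟩
      parity (triangular-count M n)                            ≡⟨ ℙ.+-identityʳ _ ⟨
      parity (triangular-count M n) + 0ℙ                       ≡⟨ cong (parity (triangular-count M n) +_) (q^-≢ (triangular M) n T≢n) ⟨
      parity (triangular-count M n) + (q ^ triangular M) n     ∎
    where open ≡-Reasoning

  -- The powers in `theta m` have triangular exponents of index 0 to 2m, hence the bound 2m + 1.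
  theta-coefficient : ∀ m → theta m ≗ parity ∘ triangular-count (suc (2 ℕ.* m))
  theta-coefficient zero    n = sym (parity-triangular-count-suc 0 n)
  theta-coefficient (suc m) n = begin
    theta m n + ((q ^ t₁) n + (q ^ t₂) n)
      ≡⟨ ℙ.+-assoc (theta m n) _ _ ⟨
    theta m n + (q ^ t₁) n + (q ^ t₂) n
      ≡⟨ cong₂ (λ j k → theta m n + (q ^ j) n + (q ^ k) n) (sym (exponent₁ m)) (sym (exponent₂ m)) ⟩
    theta m n + (q ^ triangular (suc M)) n + (q ^ triangular (2 ℕ.+ M)) n
      ≡⟨ cong (λ x → x + (q ^ triangular (suc M)) n + (q ^ triangular (2 ℕ.+ M)) n) (theta-coefficient m n) ⟩
    parity (triangular-count (suc M) n) + (q ^ triangular (suc M)) n + (q ^ triangular (2 ℕ.+ M)) n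
      ≡⟨ cong (_+ (q ^ triangular (2 ℕ.+ M)) n) (parity-triangular-count-suc (suc M) n) ⟨
    parity (triangular-count (2 ℕ.+ M) n) + (q ^ triangular (2 ℕ.+ M)) n
      ≡⟨ parity-triangular-count-suc (2 ℕ.+ M) n ⟨
    parity (triangular-count (3 ℕ.+ M) n)
      ≡⟨ cong (λ k → parity (triangular-count (suc k) n)) (ℕ.*-suc 2 m) ⟨
    parity (triangular-count (suc (2 ℕ.* suc m)) n) ∎
    where
    open ≡-Reasoning
    M  = 2 ℕ.* m
    t₁ = suc m ℕ.* suc (2 ℕ.* m)
    t₂ = suc m ℕ.* suc (2 ℕ.* suc m)
    exponent₁ : ∀ m → triangular (suc (2 ℕ.* m)) ≡ suc m ℕ.* suc (2 ℕ.* m)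
    exponent₁ m = trans (cong (_/ 2) (lemma m)) (m*n/n≡m (suc m ℕ.* suc (2 ℕ.* m)) 2)
      where
      lemma : ∀ m → suc (2 ℕ.* m) ℕ.* (suc (2 ℕ.* m) ℕ.+ 1) ≡ suc m ℕ.* suc (2 ℕ.* m) ℕ.* 2
      lemma = solve-∀
    exponent₂ : ∀ m → triangular (2 ℕ.+ 2 ℕ.* m) ≡ suc m ℕ.* suc (2 ℕ.* suc m)
    exponent₂ m = trans (cong (_/ 2) (lemma m)) (m*n/n≡m (suc m ℕ.* suc (2 ℕ.* suc m)) 2)
      where
      lemma : ∀ m → (2 ℕ.+ 2 ℕ.* m) ℕ.* (2 ℕ.+ 2 ℕ.* m ℕ.+ 1) ≡ suc m ℕ.* suc (2 ℕ.* suc m) ℕ.* 2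
      lemma = solve-∀

  -- For the coefficient n the choice m = n is enough: the bound 4n on the parts excludes no
  -- partition of n, and the comparison holds below q^(4n+1).
  parity-b₄ : ∀ n → parity (b 4 n) ≡ parity (ψ n)
  parity-b₄ n = begin
    bˢ 4 n n                                        ≡⟨ bˢ-stable 4 n (3 ℕ.* n) ⟨
    bˢ 4 (3 ℕ.* n ℕ.+ n) n                          ≡⟨ cong (λ k → bˢ 4 k n) (ℕ.+-comm (3 ℕ.* n) n) ⟩
    bˢ 4 (4 ℕ.* n) n                                ≡⟨ cancel-unit-mod {u} {theta (2 ℕ.* n)} {bˢ 4 (4 ℕ.* n)} (euler-0 {q ⊛ q ⊛ (q ⊛ q)} n refl)
                                                        (theta≈inverse n (bˢ 4 (4 ℕ.* n)) (bˢ₄-inverse n)) n<4n+1 ⟨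
    theta (2 ℕ.* n) n                              ≡⟨ theta-coefficient (2 ℕ.* n) n ⟩
    parity (triangular-count (suc (2 ℕ.* (2 ℕ.* n))) n) ≡⟨ cong (λ k → parity (triangular-count k n)) (lemma n) ⟩
    parity (triangular-count (3 ℕ.* n ℕ.+ suc n) n)     ≡⟨ cong parity (triangular-count-stable n (3 ℕ.* n)) ⟩
    parity (ψ n)                                   ∎
    where
    open ≡-Reasoning
    u = euler (q ⊛ q ⊛ (q ⊛ q)) n
    lemma : ∀ n → suc (2 ℕ.* (2 ℕ.* n)) ≡ 3 ℕ.* n ℕ.+ suc n
    lemma = solve-∀
    n<4n+1 : n ℕ.< suc (2 ℕ.* (2 ℕ.* n))
    n<4n+1 = subst (n ℕ.<_) (sym (lemma n)) (ℕ.m≤n+m (suc n) (3 ℕ.* n))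

-- Triangular numbers and odd squares.

open import Data.Integer using (+_; -1ℤ)
open SeriesOfRegularPartitions using (parity-b₄)
open import Data.Nat using (_+_; _*_; _∸_; _^_; _≤_; _<_; _≟_)
open import Data.Nat.Properties

triangular-suc : ∀ k → triangular (suc k) ≡ triangular k + suc k
triangular-suc k = begin
  suc k * (suc k + 1) / 2               ≡⟨ cong (_/ 2) (lemma k) ⟩
  (k * (k + 1) + suc k * 2) / 2         ≡⟨ +-distrib-/-∣ʳ (k * (k + 1)) (n∣m*n (suc k)) ⟩
  triangular k + suc k * 2 / 2          ≡⟨ cong (λ m → triangular k + m) (m*n/n≡m (suc k) 2) ⟩
  triangular k + suc k                  ∎
  where
  open ≡-Reasoning
  lemma : ∀ k → suc k * (suc k + 1) ≡ k * (k + 1) + suc k * 2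
  lemma = solve-∀

triangular-<-suc : ∀ k → triangular k < triangular (suc k)
triangular-<-suc k = subst (triangular k <_) (sym (triangular-suc k)) (m<m+n (triangular k) (s≤s z≤n))

triangular-mono-< : ∀ {j k} → j < k → triangular j < triangular k
triangular-mono-< {j} {suc k} (s≤s j≤k) with m≤n⇒m<n∨m≡n j≤k
... | inj₁ j<k  = <-trans (triangular-mono-< j<k) (triangular-<-suc k)
... | inj₂ refl = triangular-<-suc j

triangular-count-0 : ∀ M {n} → (∀ {k} → k < M → triangular k ≢ n) → triangular-count M n ≡ 0
triangular-count-0 zero    _    = refl
triangular-count-0 (suc M) {n} none =
  trans (triangular-count-≢ M n (none ≤-refl)) (triangular-count-0 M (none ∘ m<n⇒m<1+n))

-- Strict growth of `triangular` keeps every index other than k from being counted.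
triangular-count-1 : ∀ k d → triangular-count (d + suc k) (triangular k) ≡ 1
triangular-count-1 k zero    = trans (triangular-count-≡ k)
  (cong suc (triangular-count-0 k λ j<k → <⇒≢ (triangular-mono-< j<k)))
triangular-count-1 k (suc d) = trans
  (triangular-count-≢ (d + suc k) _ (>⇒≢ (triangular-mono-< (m≤n+m (suc k) d))))
  (triangular-count-1 k d)

ψ-triangular : ∀ k → ψ (triangular k) ≡ 1
ψ-triangular k = trans
  (cong (λ M → triangular-count M (triangular k)) (sym (m∸n+n≡m (s≤s (triangular-≥ k)))))
  (triangular-count-1 k (triangular k ∸ k))

Triangular : ℕ → Set
Triangular n = ∃ λ k → triangular k ≡ n

triangular? : ∀ n → Dec (Triangular n)
triangular? n = map′ (λ (k , _ , eq) → k , eq) (λ { (k , refl) → k , s≤s (triangular-≥ k) , refl })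
  (anyUpTo? (λ k → triangular k ≟ n) (suc n))

ψ-¬triangular : ∀ {n} → ¬ Triangular n → ψ n ≡ 0
ψ-¬triangular {n} ¬t = triangular-count-0 (suc n) λ {k} _ eq → ¬t (k , eq)

-- ψ takes only the values 0 and 1, so it is determined by its support.
ψ-cong : ∀ {m n} → (Triangular m → Triangular n) → (Triangular n → Triangular m) → ψ m ≡ ψ n
ψ-cong {m} {n} to from with triangular? m
... | no ¬t = trans (ψ-¬triangular ¬t) (sym (ψ-¬triangular (¬t ∘ from)))
... | yes t@(j , refl) with to t
...   | k , refl = trans (ψ-triangular j) (sym (ψ-triangular k))

IsSquare : ℕ → Set
IsSquare n = ∃ λ m → n ≡ m * m

8*triangular+1 : ∀ k → triangular k * 8 + 1 ≡ suc (2 * k) * suc (2 * k)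
8*triangular+1 zero    = refl
8*triangular+1 (suc k) = begin
  triangular (suc k) * 8 + 1                        ≡⟨ cong (λ t → t * 8 + 1) (triangular-suc k) ⟩
  (triangular k + suc k) * 8 + 1                    ≡⟨ lemma₁ (triangular k) k ⟩
  triangular k * 8 + 1 + suc k * 8                  ≡⟨ cong (_+ suc k * 8) (8*triangular+1 k) ⟩
  suc (2 * k) * suc (2 * k) + suc k * 8             ≡⟨ lemma₂ k ⟩
  suc (2 * suc k) * suc (2 * suc k)                 ∎
  where
  open ≡-Reasoning
  lemma₁ : ∀ t k → (t + suc k) * 8 + 1 ≡ t * 8 + 1 + suc k * 8
  lemma₁ = solve-∀
  lemma₂ : ∀ k → suc (2 * k) * suc (2 * k) + suc k * 8 ≡ suc (2 * suc k) * suc (2 * suc k)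
  lemma₂ = solve-∀

Triangular⇒IsSquare : ∀ {n} → Triangular n → IsSquare (n * 8 + 1)
Triangular⇒IsSquare (k , refl) = suc (2 * k) , 8*triangular+1 k

-- A root m of the odd number 8n + 1 is odd, and k = m / 2 is then the index of n.
IsSquare⇒Triangular : ∀ {n} → IsSquare (n * 8 + 1) → Triangular n
IsSquare⇒Triangular {n} (m , eq) with m % 2 in r | m%n<n m 2
... | 0 | _ = contradiction (∣m+n∣m⇒∣n 2∣8n+1 (∣n⇒∣m*n n (divides 4 refl))) (>⇒∤ (s≤s (s≤s z≤n)))
  where
  2∣8n+1 : 2 ∣ n * 8 + 1
  2∣8n+1 = subst (2 ∣_) (sym eq) (∣m⇒∣m*n m (m%n≡0⇒n∣m m 2 r))
... | 1 | _ = m / 2 , *-cancelʳ-≡ _ _ 8 (+-cancelʳ-≡ 1 _ _ (begin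
  triangular (m / 2) * 8 + 1                    ≡⟨ 8*triangular+1 (m / 2) ⟩
  suc (2 * (m / 2)) * suc (2 * (m / 2))         ≡⟨ cong (λ x → x * x) m≡ ⟨
  m * m                                         ≡⟨ eq ⟨
  n * 8 + 1                                     ∎))
  where
  open ≡-Reasoning
  m≡ : m ≡ suc (2 * (m / 2))
  m≡ = trans (m≡m%n+[m/n]*n m 2) (cong₂ _+_ r (*-comm (m / 2) 2))
... | suc (suc _) | s≤s (s≤s ())

parity≡0⇒2∣ : ∀ n → parity n ≡ 0ℙ → 2 ∣ n
parity≡0⇒2∣ zero          _  = 2 ∣0
parity≡0⇒2∣ (suc (suc n)) eq = ∣m∣n⇒∣m+n ∣-refl (parity≡0⇒2∣ n eq)

parity⇒mod2 : ∀ m n → parity m ≡ parity n → m ≡ n [mod 2 ]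
parity⇒mod2 zero    n       eq = parity≡0⇒2∣ n (sym eq)
parity⇒mod2 (suc m) zero    eq = parity≡0⇒2∣ (suc m) eq
parity⇒mod2 (suc m) (suc n) eq = parity⇒mod2 m n
  (trans (sym (ℙ.suc-homo-⁻¹ m)) (trans (cong _⁻¹ eq) (ℙ.suc-homo-⁻¹ n)))

b₄-even : ∀ n → ¬ IsSquare (n * 8 + 1) → b 4 n ≡ 0 [mod 2 ]
b₄-even n ¬square = parity⇒mod2 (b 4 n) 0
  (trans (parity-b₄ n) (cong parity (ψ-¬triangular {n} (¬square ∘ Triangular⇒IsSquare {n}))))

-- Square factors built from primes.

∏²-isSquare : ∀ {r} (p : Vector ℕ r) → IsSquare (∏² p)
∏²-isSquare {zero}  p = 1 , refl
∏²-isSquare {suc r} p with ∏²-isSquare (p ∘ Fin.suc)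
... | m , eq = p Fin.zero * m , trans (cong (p Fin.zero ^ 2 *_) eq) (lemma (p Fin.zero) m)
  where
  lemma : ∀ x m → x * (x * 1) * (m * m) ≡ x * m * (x * m)
  lemma = solve-∀

prime∣²⇒∣ : ∀ {p} → Prime p → ∀ m → p ∣ m * m → p ∣ m
prime∣²⇒∣ pr m = [ id , id ]′ ∘ euclidsLemma m m pr

-- By Euclid's lemma p divides the root m, and m = k p leaves n = k².
IsSquare-cancel : ∀ {p} → Prime p → ∀ n → IsSquare (p ^ 2 * n) → IsSquare n
IsSquare-cancel {p} pr n (m , eq)
  with prime∣²⇒∣ pr m (subst (p ∣_) eq (∣m⇒∣m*n n (m∣m*n (p * 1))))
... | divides k refl = k , *-cancelˡ-≡ n (k * k) (p * p) {{m*n≢0 p p}} (begin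
  p * p * n             ≡⟨ cong (λ x → p * x * n) (*-identityʳ p) ⟨
  p ^ 2 * n             ≡⟨ eq ⟩
  k * p * (k * p)       ≡⟨ lemma k p ⟩
  p * p * (k * k)       ∎)
  where
  open ≡-Reasoning
  instance _ = prime⇒nonZero pr
  lemma : ∀ k p → k * p * (k * p) ≡ p * p * (k * k)
  lemma = solve-∀

∏²-cancel : ∀ {r} (p : Vector ℕ r) → (∀ s → Prime (p s)) → ∀ n →
            IsSquare (∏² p * n) → IsSquare n
∏²-cancel {zero}  p pr n sq = subst IsSquare (*-identityˡ n) sq
∏²-cancel {suc r} p pr n sq = ∏²-cancel (p ∘ Fin.suc) (pr ∘ Fin.suc) n
  (IsSquare-cancel (pr Fin.zero) _ (subst IsSquare (*-assoc (p Fin.zero ^ 2) (∏² (p ∘ Fin.suc)) n) sq))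

-- The fold in `∏²` splits off the first prime, whereas the progressions single out the last.
∏²-init-last : ∀ {r} (p : Vector ℕ (suc r)) → ∏² p ≡ ∏² (init p) * last p ^ 2
∏²-init-last {zero}  p = *-comm (p Fin.zero ^ 2) 1
∏²-init-last {suc r} p = trans (cong (p Fin.zero ^ 2 *_) (∏²-init-last (p ∘ Fin.suc)))
  (sym (*-assoc (p Fin.zero ^ 2) (∏² (init p ∘ Fin.suc)) (last p ^ 2)))

-- The three families of arithmetic progressions.

∏²-dissection : ∀ {r} (p : Vector ℕ r) → (∀ s → OddPrime (p s)) → ∀ n →
  (∏² p * n + (∏² p ∸ 1) / 8) * 8 + 1 ≡ ∏² p * (n * 8 + 1)
∏²-dissection p op n = begin
  (P * n + (P ∸ 1) / 8) * 8 + 1           ≡⟨ lemma₁ P n ((P ∸ 1) / 8) ⟩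
  P * (n * 8) + ((P ∸ 1) / 8 * 8 + 1)     ≡⟨ cong (λ x → P * (n * 8) + x) (exact₁ p op) ⟩
  P * (n * 8) + P                         ≡⟨ lemma₂ P (n * 8) ⟩
  P * (n * 8 + 1)                         ∎
  where
  open ≡-Reasoning
  P = ∏² p
  lemma₁ : ∀ P n e → (P * n + e) * 8 + 1 ≡ P * (n * 8) + (e * 8 + 1)
  lemma₁ = solve-∀
  lemma₂ : ∀ P m → P * m + P ≡ P * (m + 1)
  lemma₂ = solve-∀

-- A square factor can be inserted as well as cancelled, so 8N + 1 and 8n + 1 are squares together.
b₄-dissection : (r : ℕ) (p : Vector ℕ r) → (∀ s → OddPrime (p s)) →
    (λ n → b 4 (∏² p * n + (∏² p ∸ 1) / 8)) ≋ ψ [mod 2 ]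
b₄-dissection r p op n = parity⇒mod2 (b 4 N) (ψ n) (trans (parity-b₄ N) (cong parity (ψ-cong {N} {n} to from)))
  where
  N = ∏² p * n + (∏² p ∸ 1) / 8
  to : Triangular N → Triangular n
  to t = IsSquare⇒Triangular (∏²-cancel p (proj₁ ∘ op) (n * 8 + 1)
    (subst IsSquare (∏²-dissection p op n) (Triangular⇒IsSquare t)))
  from : Triangular n → Triangular N
  from t with Triangular⇒IsSquare t | ∏²-isSquare p
  ... | j , eq | k , eq′ = IsSquare⇒Triangular (k * j ,
    trans (∏²-dissection p op n) (trans (cong₂ _*_ eq′ eq) (lemma k j)))
    where
    lemma : ∀ k j → k * k * (j * j) ≡ k * j * (k * j)
    lemma = solve-∀

-- Euclid's lemma on 8 = 2 * 4 reduces a prime divisor to a divisor of 2, hence to 2 itself.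
oddPrime∤8 : ∀ {p} → OddPrime p → p ∤ 8
oddPrime∤8 {p} (pr , odd) p∣8 = odd (subst (2 ∣_) 2≡p ∣-refl)
  where
  p∣2 : p ∣ 2
  p∣2 = [ id , [ id , id ]′ ∘ euclidsLemma 2 2 pr ]′ (euclidsLemma 2 4 pr p∣8)
  2≡p : 2 ≡ p
  2≡p with prime⇒irreducible (toWitness {a? = prime? 2} _) p∣2
  ... | inj₁ refl = contradiction (prime⇒nonTrivial pr) λ ()
  ... | inj₂ eq   = sym eq

-- A square divisible by p is divisible by p².
IsSquare⇒p∣i : ∀ {p} → OddPrime p → ∀ n i → IsSquare (p * (p * n + (8 * i + p))) → p ∣ i
IsSquare⇒p∣i {p} op@(pr , _) n i (m , eq) with prime∣²⇒∣ pr m (subst (p ∣_) eq (m∣m*n _))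
... | divides k refl = [ (λ p∣8 → contradiction p∣8 (oddPrime∤8 op)) , id ]′ (euclidsLemma 8 i pr p∣8i)
  where
  instance _ = prime⇒nonZero pr
  lemma : ∀ k p → k * p * (k * p) ≡ p * (p * (k * k))
  lemma = solve-∀
  -- Cancelling one p gives p k² = p n + (8i + p); removing the multiples of p leaves 8i.
  p∣8i : p ∣ 8 * i
  p∣8i = ∣m+n∣m⇒∣n (subst (p ∣_) (+-comm (8 * i) p)
    (∣m+n∣m⇒∣n (subst (p ∣_) (sym (*-cancelˡ-≡ _ (p * (k * k)) p (trans eq (lemma k p)))) (m∣m*n (k * k)))
      (m∣m*n n))) ∣-refl

-- If 8N + 1 were a square, the last prime would divide i, which lies strictly between 0 and that
-- prime.
b₄-even-divisible : (r : ℕ) (p : Vector ℕ (suc r)) → (∀ s → OddPrime (p s)) →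
    (n i : ℕ) → 1 ≤ i → i ≤ last p ∸ 1 →
    b 4 (∏² p * n + ((8 * i + last p) * (∏² (init p) * last p) ∸ 1) / 8) ≡ 0 [mod 2 ]
b₄-even-divisible r p op n i 1≤i i≤l∸1 = b₄-even N λ sq → l∤i (IsSquare⇒p∣i lop (8 * n) i
  (∏²-cancel (init p) (proj₁ ∘ op ∘ inject₁) (l * (l * (8 * n) + (8 * i + l))) (subst IsSquare 8N+1 sq)))
  where
  open ≡-Reasoning
  l = last p
  Q = ∏² (init p)
  lop = op (fromℕ r)
  e = ((8 * i + l) * (Q * l) ∸ 1) / 8
  N = ∏² p * n + e
  instance
    _ = prime⇒nonZero (proj₁ lop)
    _ = >-nonZero 1≤i

  8N+1 : N * 8 + 1 ≡ Q * (l * (l * (8 * n) + (8 * i + l)))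
  8N+1 = begin
    (∏² p * n + e) * 8 + 1                           ≡⟨ cong (λ P → (P * n + e) * 8 + 1) (∏²-init-last p) ⟩
    (Q * (l * (l * 1)) * n + e) * 8 + 1              ≡⟨ lemma₁ Q l n e ⟩
    Q * (l * (l * (8 * n))) + (e * 8 + 1)            ≡⟨ cong (λ x → Q * (l * (l * (8 * n))) + x) (exact₂ p op i) ⟩
    Q * (l * (l * (8 * n))) + (8 * i + l) * (Q * l)  ≡⟨ lemma₂ Q l (l * (8 * n)) (8 * i + l) ⟩
    Q * (l * (l * (8 * n) + (8 * i + l)))            ∎
    where
    lemma₁ : ∀ Q l n e → (Q * (l * (l * 1)) * n + e) * 8 + 1 ≡ Q * (l * (l * (8 * n))) + (e * 8 + 1)
    lemma₁ = solve-∀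
    lemma₂ : ∀ Q l x y → Q * (l * x) + y * (Q * l) ≡ Q * (l * (x + y))
    lemma₂ = solve-∀

  l∤i : l ∤ i
  l∤i l∣i = <-irrefl refl (≤-<-trans (∣⇒≤ l∣i) (≤-<-trans i≤l∸1 (∸-monoʳ-< {l} (s≤s z≤n) (>-nonZero⁻¹ l))))

legendre≡-1⇒¬SquareMod : ∀ {a p} → legendre a p ≡ -1ℤ → ¬ SquareMod p a
legendre≡-1⇒¬SquareMod {a} {p} eq with p ∣? ℤ.∣ a ∣ | squareMod? p a
legendre≡-1⇒¬SquareMod () | yes _ | _
legendre≡-1⇒¬SquareMod () | no _  | yes _
legendre≡-1⇒¬SquareMod _  | no _  | no ¬sq = ¬sq

-- A root m of p c + a is a root of a modulo p. As `SquareMod` asks for an element of `Fin p`, the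
-- witness is the remainder of m.
IsSquare⇒SquareMod : ∀ p .{{_ : NonZero p}} {a c} → IsSquare (p * c + a) → SquareMod p (+ a)
IsSquare⇒SquareMod p {a} {c} (m , eq) = fromℕ< (m%n<n m p) ,
  ℤ.∣⇒∣ᵤ (subst (λ x → (+ p) ℤ.∣ (+ x) ℤ.^ 2 ℤ.- + a) (sym (toℕ-fromℕ< (m%n<n m p)))
    (ℤ.divides (+ c ℤ.- + k) difference))
  where
  open ≡-Reasoning
  x = m % p
  -- From m = x + t p with t = m / p, this is the k with m² = x² + k p. Hence x² - a = (c - k) p,
  -- where c - k may be negative.
  k = m / p * (2 * x + m / p * p)
  expand : ∀ x t p → (x + t * p) * (x + t * p) ≡ x * x + t * (2 * x + t * p) * p
  expand = solve-∀
  sum≡ : p * c + a ≡ x * x + k * p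
  sum≡ = trans eq (trans (cong (λ y → y * y) (m≡m%n+[m/n]*n m p)) (expand x (m / p) p))
  sumℤ : + p ℤ.* + c ℤ.+ + a ≡ + x ℤ.* + x ℤ.+ + k ℤ.* + p
  sumℤ = begin
    + p ℤ.* + c ℤ.+ + a               ≡⟨ cong (ℤ._+ + a) (ℤ.pos-* p c) ⟨
    + (p * c + a)                     ≡⟨ cong +_ sum≡ ⟩
    + (x * x + k * p)                 ≡⟨ cong₂ ℤ._+_ (ℤ.pos-* x x) (ℤ.pos-* k p) ⟩
    + x ℤ.* + x ℤ.+ + k ℤ.* + p       ∎
  lemma₁ : ∀ x k p a → x ℤ.* (x ℤ.* + 1) ℤ.- a ≡ x ℤ.* x ℤ.+ k ℤ.* p ℤ.- k ℤ.* p ℤ.- a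
  lemma₁ = ℤSolver.solve-∀
  lemma₂ : ∀ p c a k → p ℤ.* c ℤ.+ a ℤ.- k ℤ.* p ℤ.- a ≡ (c ℤ.- k) ℤ.* p
  lemma₂ = ℤSolver.solve-∀
  difference : (+ x) ℤ.^ 2 ℤ.- + a ≡ (+ c ℤ.- + k) ℤ.* + p
  difference = begin
    (+ x) ℤ.^ 2 ℤ.- + a                                          ≡⟨ lemma₁ (+ x) (+ k) (+ p) (+ a) ⟩
    + x ℤ.* + x ℤ.+ + k ℤ.* + p ℤ.- + k ℤ.* + p ℤ.- + a          ≡⟨ cong (λ y → y ℤ.- + k ℤ.* + p ℤ.- + a) sumℤ ⟨
    + p ℤ.* + c ℤ.+ + a ℤ.- + k ℤ.* + p ℤ.- + a                  ≡⟨ lemma₂ (+ p) (+ c) (+ a) (+ k) ⟩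
    (+ c ℤ.- + k) ℤ.* + p                                        ∎

-- Without the square factor from the first r primes, 8N + 1 becomes a number congruent to 8j + 1
-- modulo the last prime, so its being a square would contradict the Legendre symbol.
b₄-even-nonresidue : (r : ℕ) (p : Vector ℕ (suc r)) → (∀ s → OddPrime (p s)) →
    (n j : ℕ) → j ≤ last p ∸ 1 → legendre (+ (8 * j + 1)) (last p) ≡ -1ℤ →
    b 4 (∏² (init p) * last p * n + ((8 * j + 1) * ∏² (init p) ∸ 1) / 8) ≡ 0 [mod 2 ]
b₄-even-nonresidue r p op n j _ leg = b₄-even N λ sq →
  legendre≡-1⇒¬SquareMod {+ (8 * j + 1)} {l} leg (IsSquare⇒SquareMod l
    (∏²-cancel (init p) (proj₁ ∘ op ∘ inject₁) (l * (8 * n) + (8 * j + 1)) (subst IsSquare 8N+1 sq)))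
  where
  open ≡-Reasoning
  l = last p
  Q = ∏² (init p)
  e = ((8 * j + 1) * Q ∸ 1) / 8
  N = Q * l * n + e
  instance
    _ = prime⇒nonZero (proj₁ (op (fromℕ r)))

  8N+1 : N * 8 + 1 ≡ Q * (l * (8 * n) + (8 * j + 1))
  8N+1 = begin
    (Q * l * n + e) * 8 + 1                    ≡⟨ lemma₁ Q l n e ⟩
    Q * (l * (8 * n)) + (e * 8 + 1)            ≡⟨ cong (λ x → Q * (l * (8 * n)) + x) (exact₃ (init p) (op ∘ inject₁) j) ⟩
    Q * (l * (8 * n)) + (8 * j + 1) * Q        ≡⟨ lemma₂ Q (l * (8 * n)) (8 * j + 1) ⟩
    Q * (l * (8 * n) + (8 * j + 1))            ∎
    where
    lemma₁ : ∀ Q l n e → (Q * l * n + e) * 8 + 1 ≡ Q * (l * (8 * n)) + (e * 8 + 1)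
    lemma₁ = solve-∀
    lemma₂ : ∀ Q x y → Q * x + y * Q ≡ Q * (x + y)
    lemma₂ = solve-∀

theorem3p12 : ((r : ℕ) (p : Vector ℕ r) → (∀ s → OddPrime (p s)) →
    (λ n → b 4 (∏² p * n + (∏² p ∸ 1) / 8)) ≋ ψ [mod 2 ])
    × ((r : ℕ) (p : Vector ℕ (suc r)) → (∀ s → OddPrime (p s)) →
    (n i : ℕ) → 1 ≤ i → i ≤ last p ∸ 1 →
    b 4 (∏² p * n + ((8 * i + last p) * (∏² (init p) * last p) ∸ 1) / 8) ≡ 0 [mod 2 ])
    × ((r : ℕ) (p : Vector ℕ (suc r)) → (∀ s → OddPrime (p s)) →
    (n j : ℕ) → j ≤ last p ∸ 1 → legendre (+ (8 * j + 1)) (last p) ≡ -1ℤ →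
    b 4 (∏² (init p) * last p * n + ((8 * j + 1) * ∏² (init p) ∸ 1) / 8) ≡ 0 [mod 2 ])
theorem3p12 = b₄-dissection , b₄-even-divisible , b₄-even-nonresidue
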